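{- There are positive constants $c$ and $c'$ such that for all integers $n\ge 2$, \[ 2^{c\log^2 n}\;\le\; \mathrm{gr}(\Gamma_{2\times 2},K_n)\;\le\; 2^{c' n^{2/3}\log n}. \]
   Context: The $m\times n$ grid graph $\Gamma_{m\times n}$ is the Cartesian product $K_m\square K_n$: its vertex set is $[m]\times[n]$ and two distinct vertices are adjacent iff they share exactly one coordinate. An $a\times b$ subgrid of $\Gamma_{m\times n}$ is an induced copy of $\Gamma_{a\times b}$, i.e. the induced subgraph on $X\times Y$ with $X\subseteq[m]$, $|X|=a$, $Y\subseteq[n]$, $|Y|=b$ (or with the roles of the coordinates swapped). A rectangle is a $2\times 2$ subgrid, i.e. four vertices $(x,y),(x,y'),(x',y'),(x',y)$ with $x\neq x'$, $y\ne y'$, together with the four edges between them sharing a coordinate. $\mathrm{gr}(\Gamma_{2\times2},K_n)$ is the smallest $N$ such that every red/blue coloring of the edges of $\Gamma_{N\times N}$ contains a rectangle all of whose four edges are red, or a clique on $n$ vertices (in $\Gamma_{N\times N}$) all of whose edges are blue. Logarithms are base $2$. -}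

module Defs where

open import Data.Nat using (ℕ; zero; suc; _+_; _*_; _^_; _≤_)
open import Data.Nat.Logarithm using (⌊log₂_⌋; ⌈log₂_⌉)
open import Data.Fin using (Fin)
open import Data.Product using (_×_; _,_; Σ; ∃)
open import Data.Sum using (_⊎_)
open import Relation.Binary.PropositionalEquality using (_≡_; _≢_)
open import Relation.Nullary using (¬_)

Vertex : ℕ → Set
Vertex N = Fin N × Fin N

Adj : ∀ {N} → Vertex N → Vertex N → Set
Adj (x , y) (x' , y') = (x ≡ x' × y ≢ y') ⊎ (x ≢ x' × y ≡ y')

data Colour : Set where
  red blue : Colour

-- A red/blue edge colouring of Γ_{N×N}: a colour for every (ordered) pair of
-- vertices, symmetric, so that it is a colouring of unordered edges.
-- (Values on non-adjacent pairs are irrelevant.)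
record Colouring (N : ℕ) : Set where
  field
    col  : Vertex N → Vertex N → Colour
    symm : ∀ u v → col u v ≡ col v u
open Colouring public

RedRectangle : ∀ {N} → Colouring N → Set
RedRectangle {N} c =
  Σ (Fin N) λ x → Σ (Fin N) λ x' → Σ (Fin N) λ y → Σ (Fin N) λ y' →
    x ≢ x' × y ≢ y' ×
    col c (x , y)   (x , y')   ≡ red ×
    col c (x , y')  (x' , y')  ≡ red ×
    col c (x' , y') (x' , y)   ≡ red ×
    col c (x' , y)  (x , y)    ≡ red

BlueClique : ∀ {N} → Colouring N → ℕ → Set
BlueClique {N} c n =
  Σ (Fin n → Vertex N) λ f →
    (∀ i j → f i ≡ f j → i ≡ j) ×
    (∀ i j → i ≢ j → Adj (f i) (f j) × col c (f i) (f j) ≡ blue)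

GrArrows : ℕ → ℕ → Set
GrArrows N n = ∀ (c : Colouring N) → RedRectangle c ⊎ BlueClique c n

module Submission where

-- A blue clique of the grid lies in one row or in one column.
--
-- Lower bound.  Let the rows be words over an alphabet of size Q = 2 ^ s, any two of which agree in fewer
-- than s positions, and let the columns be all binary words of the same length.  A row edge y y′
-- carries a random letter and is red in row x if this is the letter of x at a fixed position where
-- y and y′ differ.  A column edge x x′ carries a random number below 2 ^ s and is red in column y if
-- this number encodes the bits of y at the positions where x and x′ agree.  In a red rectangle the
-- words x and x′ agree at a position where y and y′ differ, although y and y′ have the same bits
-- wherever x and x′ agree.  An edge is red with probability at least 1 / Q, so no large clique is blue.
--
-- Upper bound.  With r about n ^ (1/3), every row contains a red clique on r of the first n ^ r columns,
-- and by pigeonhole many rows share the same r columns.  Without red rectangles the red graphs of these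
-- columns are edge-disjoint on those rows, so one of them has density at most about 1 / r, and an
-- argument of Erdős and Szemerédi finds in it an independent set of size n, or else a red clique of
-- size n, which is blue in every other of the r columns.

open import Defs
open import Data.Nat
open import Data.Nat.DivMod using (_/_; _%_; m/n*n≤m; m≡m%n+[m/n]*n; m%n<n)
open import Data.Nat.Induction using (<-rec)
open import Data.Nat.ListAction using (sum)
open import Data.Nat.Logarithm
open import Data.Nat.Properties
open import Data.Nat.Tactic.RingSolver using (solve-∀)
open import Data.Fin as F
  using (Fin; zero; suc; toℕ; punchIn; punchOut; combine; remQuot; funToFin; finToFun; _↑ˡ_; _↑ʳ_; inject≤)
import Data.Fin.Properties as Fₚ
open import Data.List using (List; []; _∷_; _++_; map; length; filter; allFin; tabulate; lookup)
open import Data.List.Properties using (length-++; length-tabulate; filter-accept; filter-reject)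
open import Data.List.Membership.Propositional using (_∈_)
open import Data.List.Membership.Propositional.Properties using (∈-allFin; ∈-lookup)
open import Data.List.Relation.Binary.Sublist.Propositional using (_⊆_; []; _∷_; _∷ʳ_; ⊆-refl; ⊆-trans; minimum)
open import Data.List.Relation.Binary.Sublist.Propositional.Properties
  using (All-resp-⊆; filter-⊆; length-mono-≤)
open import Data.List.Relation.Unary.All as All using (All; []; _∷_)
import Data.List.Relation.Unary.All.Properties as Allₚ
open import Data.List.Relation.Unary.All.Properties using (All-swap; all-filter)
open import Data.List.Relation.Unary.AllPairs as AllPairs using (AllPairs; []; _∷_)
import Data.List.Relation.Unary.AllPairs.Properties as AllPairsₚ
open import Data.List.Relation.Unary.Any using (here; there)
open import Data.List.Relation.Unary.Unique.Propositional using (Unique)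
open import Data.List.Relation.Unary.Unique.Propositional.Properties using (allFin⁺)
open import Data.Product using (Σ; ∃; _×_; _,_; proj₁; proj₂)
open import Data.Sum using (_⊎_; inj₁; inj₂)
open import Data.Vec.Functional as V using ()
open import Function using (_∘_; id)
open import Relation.Binary.PropositionalEquality hiding (J)
open import Relation.Nullary
open import Relation.Nullary.Decidable using (_→-dec_; _×-dec_; _⊎-dec_; ¬?; decidable-stable)

private variable
  A B : Set


-- Finite sums and products

∑ : List A → (A → ℕ) → ℕ
∑ xs f = sum (map f xs)

∑-mono : ∀ (xs : List A) {f g} → (∀ x → f x ≤ g x) → ∑ xs f ≤ ∑ xs g
∑-mono []       h = z≤n
∑-mono (x ∷ xs) h = +-mono-≤ (h x) (∑-mono xs h)

∑-cong : ∀ (xs : List A) {f g} → (∀ x → f x ≡ g x) → ∑ xs f ≡ ∑ xs g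
∑-cong []       h = refl
∑-cong (x ∷ xs) h = cong₂ _+_ (h x) (∑-cong xs h)

∑-+ : ∀ (xs : List A) f g → ∑ xs (λ x → f x + g x) ≡ ∑ xs f + ∑ xs g
∑-+ []       f g = refl
∑-+ (x ∷ xs) f g rewrite ∑-+ xs f g = lemma (f x) (g x) (∑ xs f) (∑ xs g)
  where
  lemma : ∀ a b c d → (a + b) + (c + d) ≡ (a + c) + (b + d)
  lemma = solve-∀

∑-* : ∀ (xs : List A) c f → ∑ xs (λ x → c * f x) ≡ c * ∑ xs f
∑-* []       c f = sym (*-zeroʳ c)
∑-* (x ∷ xs) c f rewrite ∑-* xs c f = sym (*-distribˡ-+ c (f x) _)

∑-const : ∀ (xs : List A) c → ∑ xs (λ _ → c) ≡ length xs * c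
∑-const []       c = refl
∑-const (x ∷ xs) c = cong (c +_) (∑-const xs c)

∑-swap : ∀ (xs : List A) (ys : List B) (f : A → B → ℕ) →
         ∑ xs (λ x → ∑ ys (f x)) ≡ ∑ ys (λ y → ∑ xs (λ x → f x y))
∑-swap []       ys f = sym (trans (∑-const ys 0) (*-zeroʳ (length ys)))
∑-swap (x ∷ xs) ys f rewrite ∑-swap xs ys f = sym (∑-+ ys (f x) _)

∑-min : ∀ (x : A) xs f → ∃ λ y → length (x ∷ xs) * f y ≤ ∑ (x ∷ xs) f
∑-min x []       f = x , ≤-refl
∑-min x (z ∷ xs) f with ∑-min z xs f
... | y , h with ≤-total (f x) (f y)
... | inj₁ x≤y = x , +-monoʳ-≤ (f x) (≤-trans (*-monoʳ-≤ (length (z ∷ xs)) x≤y) h)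
... | inj₂ y≤x = y , +-mono-≤ y≤x h

∑-max : ∀ (x : A) xs f → ∃ λ y → ∑ (x ∷ xs) f ≤ length (x ∷ xs) * f y
∑-max x []       f = x , ≤-refl
∑-max x (z ∷ xs) f with ∑-max z xs f
... | y , h with ≤-total (f y) (f x)
... | inj₁ y≤x = x , +-monoʳ-≤ (f x) (≤-trans h (*-monoʳ-≤ (length (z ∷ xs)) y≤x))
... | inj₂ x≤y = y , +-mono-≤ x≤y h

length-allFin : ∀ n → length (allFin n) ≡ n
length-allFin n = length-tabulate {n = n} id

𝟙 : {P : Set} → Dec P → ℕ
𝟙 (yes _) = 1
𝟙 (no _)  = 0

𝟙-yes : ∀ {P : Set} (P? : Dec P) → P → 𝟙 P? ≡ 1
𝟙-yes (yes _) _ = refl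
𝟙-yes (no ¬p) p = contradiction p ¬p

𝟙-no : ∀ {P : Set} (P? : Dec P) → ¬ P → 𝟙 P? ≡ 0
𝟙-no (yes p) ¬p = contradiction p ¬p
𝟙-no (no _)  _  = refl

𝟙≤1 : ∀ {P : Set} (P? : Dec P) → 𝟙 P? ≤ 1
𝟙≤1 (yes _) = s≤s z≤n
𝟙≤1 (no _)  = z≤n

𝟙¬≡0 : ∀ {P : Set} (P? : Dec P) → 𝟙 (¬? P?) ≡ 0 → P
𝟙¬≡0 (yes p) _ = p

*-𝟙-≤ : ∀ {P : Set} (P? : Dec P) {a b} c → (P → c * a ≤ b) → c * (𝟙 P? * a) ≤ b
*-𝟙-≤ (yes p) {a} c h = ≤-trans (≤-reflexive (cong (c *_) (*-identityˡ a))) (h p)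
*-𝟙-≤ (no _)      c h = ≤-trans (≤-reflexive (*-zeroʳ c)) z≤n

^-distribʳ-* : ∀ n a b → (a * b) ^ n ≡ a ^ n * b ^ n
^-distribʳ-* zero    a b = refl
^-distribʳ-* (suc n) a b rewrite ^-distribʳ-* n a b = interchange a b (a ^ n) (b ^ n)
  where
  interchange : ∀ a b c d → (a * b) * (c * d) ≡ (a * c) * (b * d)
  interchange = solve-∀

∏ : ∀ m → (Fin m → ℕ) → ℕ
∏ zero    f = 1
∏ (suc m) f = f zero * ∏ m (f ∘ suc)

∏-mono : ∀ m {f g : Fin m → ℕ} → (∀ j → f j ≤ g j) → ∏ m f ≤ ∏ m g
∏-mono zero    h = ≤-refl
∏-mono (suc m) h = *-mono-≤ (h zero) (∏-mono m (h ∘ suc))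

∏-const : ∀ m c → ∏ m (λ _ → c) ≡ c ^ m
∏-const zero    c = refl
∏-const (suc m) c = cong (c *_) (∏-const m c)

∏≡0 : ∀ m (f : Fin m → ℕ) → ∏ m f ≡ 0 → ∃ λ j → f j ≡ 0
∏≡0 (suc m) f eq with m*n≡0⇒m≡0∨n≡0 (f zero) eq
... | inj₁ e = zero , e
... | inj₂ e with ∏≡0 m (f ∘ suc) e
...   | j , fj≡0 = suc j , fj≡0

∏-remove : ∀ m (f : Fin (suc m) → ℕ) p → ∏ (suc m) f ≡ f p * ∏ m (f ∘ punchIn p)
∏-remove m       f zero    = refl
∏-remove (suc m) f (suc p) rewrite ∏-remove m (f ∘ suc) p = swap (f zero) (f (suc p)) _
  where
  swap : ∀ a b c → a * (b * c) ≡ b * (a * c)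
  swap = solve-∀

-- Removing the slot `π zero` with `punchIn` leaves an injection on one index fewer, obtained with
-- `punchOut`. Multiplying by `suc K ^ M` avoids the exponent `m ∸ M`.
∏-injection : ∀ K M m (f : Fin m → ℕ) (π : Fin M → Fin m) → (∀ {i j} → π i ≡ π j → i ≡ j) →
              (∀ p → f p ≤ suc K) → (∀ i → f (π i) ≤ K) →
              ∏ m f * suc K ^ M ≤ suc K ^ m * K ^ M
∏-injection K zero m f π π-inj f≤ fπ≤ =
  *-monoˡ-≤ 1 (≤-trans (∏-mono m f≤) (≤-reflexive (∏-const m (suc K))))
∏-injection K (suc M) zero f π π-inj f≤ fπ≤ with π zero
... | ()
∏-injection K (suc M) (suc m) f π π-inj f≤ fπ≤ = begin
  ∏ (suc m) f * (suc K * suc K ^ M)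
    ≡⟨ cong (_* (suc K * suc K ^ M)) (∏-remove m f (π zero)) ⟩
  (f (π zero) * ∏ m f′) * (suc K * suc K ^ M)
    ≡⟨ interchange (f (π zero)) _ (suc K) _ ⟩
  (f (π zero) * suc K) * (∏ m f′ * suc K ^ M)
    ≤⟨ *-mono-≤ (*-monoˡ-≤ (suc K) (fπ≤ zero))
                (∏-injection K M m f′ π′ π′-inj (λ p → f≤ _) f′π′≤) ⟩
  (K * suc K) * (suc K ^ m * K ^ M)
    ≡⟨ rearrange K (suc K) (suc K ^ m) (K ^ M) ⟩
  (suc K * suc K ^ m) * (K * K ^ M) ∎
  where
  open ≤-Reasoning
  f′ : Fin m → ℕ
  f′ = f ∘ punchIn (π zero)
  π0≢ : ∀ i → π zero ≢ π (suc i)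
  π0≢ i eq with π-inj eq
  ... | ()
  π′ : Fin M → Fin m
  π′ i = punchOut (π0≢ i)
  π′-inj : ∀ {i j} → π′ i ≡ π′ j → i ≡ j
  π′-inj {i} {j} eq = Fₚ.suc-injective (π-inj (Fₚ.punchOut-injective (π0≢ i) (π0≢ j) eq))
  f′π′≤ : ∀ i → f′ (π′ i) ≤ K
  f′π′≤ i rewrite Fₚ.punchIn-punchOut (π0≢ i) = fπ≤ (suc i)
  interchange : ∀ a b c d → (a * b) * (c * d) ≡ (a * c) * (b * d)
  interchange = solve-∀
  rearrange : ∀ a b c d → (a * b) * (c * d) ≡ (b * c) * (a * d)
  rearrange = solve-∀

-- The method of conditional expectations: the slots are filled one after the other, each with a
-- value that does not increase the expected total weight.
derandomise : ∀ {E : Set} (es : List E) K m (w : E → ℕ) (g : E → Fin m → Fin (suc K) → ℕ) →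
  ∃ λ (ω : Fin m → Fin (suc K)) →
    suc K ^ m * ∑ es (λ e → w e * ∏ m (λ j → g e j (ω j)))
      ≤ ∑ es (λ e → w e * ∏ m (λ j → ∑ (allFin (suc K)) (g e j)))
derandomise es K zero    w g = (λ ()) , ≤-reflexive (*-identityˡ _)
derandomise {E} es K (suc m) w g = b V.∷ ω , bound
  where
  open ≤-Reasoning
  rest : E → ℕ
  rest e = ∏ m (λ j → ∑ (allFin (suc K)) (g e (suc j)))
  -- The unnormalised expected weight once the first slot holds `b`. Its sum over `b` is the
  -- right-hand side of the claim, so the minimal value is at most the average.
  Φ : Fin (suc K) → ℕ
  Φ b = ∑ es (λ e → (w e * g e zero b) * rest e)
  best : ∃ λ b → length (allFin (suc K)) * Φ b ≤ ∑ (allFin (suc K)) Φ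
  best = ∑-min zero (tabulate suc) Φ
  b = proj₁ best
  IH = derandomise es K m (λ e → w e * g e zero b) (λ e j → g e (suc j))
  ω = proj₁ IH
  pull : ∀ e → ∑ (allFin (suc K)) (λ b → (w e * g e zero b) * rest e)
             ≡ w e * (∑ (allFin (suc K)) (g e zero) * rest e)
  pull e = trans (∑-cong (allFin (suc K)) (λ b → move (w e) (g e zero b) (rest e)))
          (trans (∑-* (allFin (suc K)) (w e * rest e) (g e zero))
                 (sym (move′ (w e) _ (rest e))))
    where
    move : ∀ x y z → (x * y) * z ≡ (x * z) * y
    move = solve-∀
    move′ : ∀ x y z → x * (y * z) ≡ (x * z) * y
    move′ = solve-∀
  bound : suc K ^ suc m * ∑ es (λ e → w e * (g e zero b * ∏ m (λ j → g e (suc j) (ω j))))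
            ≤ ∑ es (λ e → w e * (∑ (allFin (suc K)) (g e zero) * rest e))
  bound = begin
    suc K ^ suc m * ∑ es (λ e → w e * (g e zero b * ∏ m (λ j → g e (suc j) (ω j))))
      ≡⟨ cong (suc K ^ suc m *_) (∑-cong es (λ e → sym (*-assoc (w e) (g e zero b) _))) ⟩
    suc K ^ suc m * ∑ es (λ e → w e * g e zero b * ∏ m (λ j → g e (suc j) (ω j)))
      ≡⟨ *-assoc (suc K) (suc K ^ m) _ ⟩
    suc K * (suc K ^ m * ∑ es (λ e → w e * g e zero b * ∏ m (λ j → g e (suc j) (ω j))))
      ≤⟨ *-monoʳ-≤ (suc K) (proj₂ IH) ⟩
    suc K * Φ b
      ≡⟨ cong (_* Φ b) (sym (length-allFin (suc K))) ⟩
    length (allFin (suc K)) * Φ b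
      ≤⟨ proj₂ best ⟩
    ∑ (allFin (suc K)) Φ
      ≡⟨ ∑-swap (allFin (suc K)) es _ ⟩
    ∑ es (λ e → ∑ (allFin (suc K)) (λ b → (w e * g e zero b) * rest e))
      ≡⟨ ∑-cong es pull ⟩
    ∑ es (λ e → w e * (∑ (allFin (suc K)) (g e zero) * rest e)) ∎

-- Random assignments that hit every large set

∈⇒≤∑ : ∀ {x : A} {xs} (f : A → ℕ) → x ∈ xs → f x ≤ ∑ xs f
∈⇒≤∑ f (here refl)         = m≤m+n _ _
∈⇒≤∑ f (there {x = y} x∈) = ≤-trans (∈⇒≤∑ f x∈) (m≤n+m _ (f y))

∑-≤-length : ∀ (xs : List A) {f : A → ℕ} → (∀ x → f x ≤ 1) → ∑ xs f ≤ length xs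
∑-≤-length []       f≤1 = z≤n
∑-≤-length (x ∷ xs) f≤1 = +-mono-≤ (f≤1 x) (∑-≤-length xs f≤1)

∑-<-length : ∀ {x : A} {xs} {f : A → ℕ} → (∀ x → f x ≤ 1) → x ∈ xs → f x ≡ 0 → ∑ xs f < length xs
∑-<-length {xs = _ ∷ xs} f≤1 (here refl) eq rewrite eq = s≤s (∑-≤-length xs f≤1)
∑-<-length {xs = y ∷ _}  f≤1 (there x∈)  eq = +-mono-≤-< (f≤1 y) (∑-<-length f≤1 x∈ eq)

Inj : ∀ {m n} → (Fin m → Fin n) → Set
Inj J = ∀ a b → J a ≡ J b → a ≡ b

inj? : ∀ {m n} (J : Fin m → Fin n) → Dec (Inj J)
inj? J = Fₚ.all? λ a → Fₚ.all? λ b → (J a F.≟ J b) →-dec (a F.≟ b)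

-- The unordered pair {u , v}, encoded by its increasing enumeration.
slot : ∀ {V} → Fin V → Fin V → Fin (V * V)
slot u v with toℕ u ≤? toℕ v
... | yes _ = combine u v
... | no  _ = combine v u

slot-cases : ∀ {V} (u v : Fin V) → slot u v ≡ combine u v ⊎ slot u v ≡ combine v u
slot-cases u v with toℕ u ≤? toℕ v
... | yes _ = inj₁ refl
... | no  _ = inj₂ refl

slot-sym : ∀ {V} (u v : Fin V) → slot u v ≡ slot v u
slot-sym u v with toℕ u ≤? toℕ v | toℕ v ≤? toℕ u
... | yes p | yes q rewrite Fₚ.toℕ-injective (≤-antisym p q) = refl
... | yes p | no ¬q = refl
... | no ¬p | yes q = refl
... | no ¬p | no ¬q = contradiction (≰⇒≥ ¬p) ¬q

slot-injective : ∀ {V} (u v u′ v′ : Fin V) → slot u v ≡ slot u′ v′ →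
                 (u ≡ u′ × v ≡ v′) ⊎ (u ≡ v′ × v ≡ u′)
slot-injective u v u′ v′ eq with slot-cases u v | slot-cases u′ v′
... | inj₁ p | inj₁ q = inj₁ (Fₚ.combine-injective u v u′ v′ (trans (sym p) (trans eq q)))
... | inj₁ p | inj₂ q = inj₂ (Fₚ.combine-injective u v v′ u′ (trans (sym p) (trans eq q)))
... | inj₂ p | inj₁ q with Fₚ.combine-injective v u u′ v′ (trans (sym p) (trans eq q))
...   | r , s = inj₂ (s , r)
slot-injective u v u′ v′ eq | inj₂ p | inj₂ q
    with Fₚ.combine-injective v u v′ u′ (trans (sym p) (trans eq q))
...   | r , s = inj₁ (s , r)

ends : ∀ {V} → Fin (V * V) → Fin V × Fin V
ends {V} = remQuot V

ends-slot : ∀ {V} (u v : Fin V) → ends (slot u v) ≡ (u , v) ⊎ ends (slot u v) ≡ (v , u)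
ends-slot u v with slot-cases u v
... | inj₁ p = inj₁ (trans (cong ends p) (Fₚ.remQuot-combine u v))
... | inj₂ p = inj₂ (trans (cong ends p) (Fₚ.remQuot-combine v u))

↑ˡ≢↑ʳ : ∀ {m n} (a : Fin m) (b : Fin n) → a ↑ˡ n ≢ m ↑ʳ b
↑ˡ≢↑ʳ {m} {n} a b eq
    with trans (sym (Fₚ.splitAt-↑ˡ m a n)) (trans (cong (F.splitAt m) eq) (Fₚ.splitAt-↑ʳ m n b))
... | ()

-- `ends` recovers an unordered pair only up to order, so a property of it is checked for both
-- orders.
ends-slot-elim : ∀ {V} (P : Fin V × Fin V → Set) (u v : Fin V) → P (u , v) → P (v , u) → P (ends (slot u v))
ends-slot-elim P u v p q with ends-slot u v
... | inj₁ eq = subst P (sym eq) p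
... | inj₂ eq = subst P (sym eq) q

-- The h² pairs between the two halves of 2h distinct vertices are distinct slots, so that a random
-- assignment misses all of them with probability at most (K / suc K) ^ h²; the hypothesis small
-- leaves room for a union bound over all e and all tuples.
module Hitting (E V K h : ℕ) (target : Fin E → Fin (V * V) → ℕ)
  (target≤K : ∀ e (u v : Fin V) → u ≢ v → target e (slot u v) ≤ K)
  (small : E * V ^ (h + h) * K ^ (h * h) < suc K ^ (h * h)) where

  private
    -- An index and a tuple in a single number, so that the union bound is one sum.
    Event = Fin (E * V ^ (h + h))

    index : Event → Fin E
    index ε = proj₁ (remQuot (V ^ (h + h)) ε)

    tuple : Event → Fin (h + h) → Fin V
    tuple ε = finToFun (proj₂ (remQuot {E} (V ^ (h + h)) ε))

    pairAt : (Fin (h + h) → Fin V) → Fin (h * h) → Fin (V * V)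
    pairAt J i = slot (J (proj₁ (remQuot {h} h i) ↑ˡ h)) (J (h ↑ʳ proj₂ (remQuot {h} h i)))

    -- A slot that is no pair of the tuple is never hit. It contributes the full factor `suc K` to
    -- the expectation, and the product of `missed` is 1 exactly when every pair of the tuple
    -- misses.
    Hit : Event → Fin (V * V) → Fin (suc K) → Set
    Hit ε p b = (∃ λ i → pairAt (tuple ε) i ≡ p) × toℕ b ≡ target (index ε) p

    hit? : ∀ ε p b → Dec (Hit ε p b)
    hit? ε p b = Fₚ.any? (λ i → pairAt (tuple ε) i F.≟ p) ×-dec (toℕ b ≟ target (index ε) p)

    missed : Event → Fin (V * V) → Fin (suc K) → ℕ
    missed ε p b = 𝟙 (¬? (hit? ε p b))

    -- Tuples with repetitions get weight 0, since their pairs need not be distinct slots.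
    weight : Event → ℕ
    weight ε = 𝟙 (inj? (tuple ε))

    misses : Event → Fin (V * V) → ℕ
    misses ε p = ∑ (allFin (suc K)) (missed ε p)

    halves-distinct : ∀ {J : Fin (h + h) → Fin V} → Inj J → ∀ a b → J (a ↑ˡ h) ≢ J (h ↑ʳ b)
    halves-distinct J-inj a b eq = ↑ˡ≢↑ʳ a b (J-inj _ _ eq)

    pairAt-injective : ∀ J → Inj J → ∀ {i j} → pairAt J i ≡ pairAt J j → i ≡ j
    pairAt-injective J J-inj {i} {j} eq
      with slot-injective _ _ _ _ eq
    ... | inj₂ (p , _) = contradiction p (halves-distinct J-inj _ _)
    ... | inj₁ (p , q) =
      trans (sym (Fₚ.combine-remQuot {h} h i))
        (trans (cong₂ combine (Fₚ.↑ˡ-injective h _ _ (J-inj _ _ p)) (Fₚ.↑ʳ-injective h _ _ (J-inj _ _ q)))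
               (Fₚ.combine-remQuot {h} h j))

    misses≤ : ∀ ε p → misses ε p ≤ suc K
    misses≤ ε p = ≤-trans (∑-≤-length (allFin (suc K)) (λ b → 𝟙≤1 (¬? (hit? ε p b))))
                          (≤-reflexive (length-allFin (suc K)))

    misses-pairAt≤ : ∀ ε → Inj (tuple ε) → ∀ i → misses ε (pairAt (tuple ε) i) ≤ K
    misses-pairAt≤ ε J-inj i = ≤-pred (≤-trans
      (∑-<-length (λ b → 𝟙≤1 (¬? (hit? ε p b))) (∈-allFin b₀)
        (𝟙-no (¬? (hit? ε p b₀)) (λ ¬hit → ¬hit ((i , refl) , Fₚ.toℕ-fromℕ< bound))))
      (≤-reflexive (length-allFin (suc K))))
      where
      p = pairAt (tuple ε) i
      bound : target (index ε) p < suc K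
      bound = s≤s (target≤K (index ε) _ _ (halves-distinct J-inj _ _))
      -- The target itself, as a value in range, is a value that does not count as a miss.
      b₀ = F.fromℕ< bound

    event-bound : ∀ ε → suc K ^ (h * h) * (weight ε * ∏ (V * V) (misses ε))
                          ≤ suc K ^ (V * V) * K ^ (h * h)
    event-bound ε = *-𝟙-≤ (inj? (tuple ε)) (suc K ^ (h * h)) λ J-inj → ≤-trans
      (≤-reflexive (*-comm (suc K ^ (h * h)) _))
      (∏-injection K (h * h) (V * V) (misses ε) (pairAt (tuple ε))
        (pairAt-injective (tuple ε) J-inj) (misses≤ ε) (misses-pairAt≤ ε J-inj))

    events = allFin (E * V ^ (h + h))
    chosen = derandomise events K (V * V) weight missed

  ω : Fin (V * V) → Fin (suc K)
  ω = proj₁ chosen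

  private
    failures = ∑ events (λ ε → weight ε * ∏ (V * V) (λ p → missed ε p (ω p)))

    -- The expected number of failures is at most `E * V ^ (h + h)` times `(K / suc K) ^ (h * h)`,
    -- which is below 1 by `small`; so the chosen assignment has none.
    failures≡0 : failures ≡ 0
    failures≡0 with failures in eq
    ... | zero = refl
    ... | suc f = contradiction absurd (<-irrefl refl)
      where
      open ≤-Reasoning
      M = h * h
      m = V * V
      instance _ = m^n≢0 (suc K) m
      shuffle : ∀ a b c → a * (b * c) ≡ b * (a * c)
      shuffle = solve-∀
      absurd : suc K ^ m * suc K ^ M < suc K ^ m * suc K ^ M
      absurd = begin-strict
        suc K ^ m * suc K ^ M
          ≤⟨ m≤m*n _ (suc f) ⟩
        suc K ^ m * suc K ^ M * suc f
          ≡⟨ rearrange (suc K ^ m) (suc K ^ M) (suc f) ⟩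
        suc K ^ M * (suc K ^ m * suc f)
          ≡⟨ cong (λ x → suc K ^ M * (suc K ^ m * x)) (sym eq) ⟩
        suc K ^ M * (suc K ^ m * failures)
          ≤⟨ *-monoʳ-≤ (suc K ^ M) (proj₂ chosen) ⟩
        suc K ^ M * ∑ events (λ ε → weight ε * ∏ m (misses ε))
          ≡⟨ sym (∑-* events (suc K ^ M) _) ⟩
        ∑ events (λ ε → suc K ^ M * (weight ε * ∏ m (misses ε)))
          ≤⟨ ∑-mono events event-bound ⟩
        ∑ events (λ _ → suc K ^ m * K ^ M)
          ≡⟨ trans (∑-const events _) (cong (_* (suc K ^ m * K ^ M)) (length-allFin (E * V ^ (h + h)))) ⟩
        E * V ^ (h + h) * (suc K ^ m * K ^ M)
          ≡⟨ shuffle (E * V ^ (h + h)) (suc K ^ m) (K ^ M) ⟩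
        suc K ^ m * (E * V ^ (h + h) * K ^ M)
          <⟨ *-monoʳ-< (suc K ^ m) small ⟩
        suc K ^ m * suc K ^ M ∎
        where
        rearrange : ∀ a b c → a * b * c ≡ b * (a * c)
        rearrange = solve-∀

  -- No event fails and this tuple has weight 1, so some factor of its product vanishes, which gives
  -- a slot that is hit.
  hits : ∀ e (J : Fin (h + h) → Fin V) → Inj J →
         ∃ λ a → ∃ λ b → J a ≢ J b × toℕ (ω (slot (J a) (J b))) ≡ target e (slot (J a) (J b))
  hits e J J-inj = conclude hit
    where
    ε : Event
    ε = combine e (funToFin J)
    index≡ : index ε ≡ e
    index≡ = cong proj₁ (Fₚ.remQuot-combine e (funToFin J))
    tuple≗ : ∀ a → tuple ε a ≡ J a
    tuple≗ a = trans (cong (λ q → finToFun (proj₂ q) a) (Fₚ.remQuot-combine e (funToFin J)))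
                     (Fₚ.finToFun-funToFin J a)
    tuple-inj : Inj (tuple ε)
    tuple-inj a b eq = J-inj a b (trans (sym (tuple≗ a)) (trans eq (tuple≗ b)))
    term≡0 : weight ε * ∏ (V * V) (λ p → missed ε p (ω p)) ≡ 0
    term≡0 = n≤0⇒n≡0 (≤-trans (∈⇒≤∑ _ (∈-allFin ε)) (≤-reflexive failures≡0))
    product≡0 : ∏ (V * V) (λ p → missed ε p (ω p)) ≡ 0
    product≡0 with m*n≡0⇒m≡0∨n≡0 (weight ε) term≡0
    ... | inj₂ z = z
    ... | inj₁ z with trans (sym (𝟙-yes (inj? (tuple ε)) tuple-inj)) z
    ...   | ()
    hit : ∃ λ p → Hit ε p (ω p)
    hit with ∏≡0 (V * V) (λ p → missed ε p (ω p)) product≡0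
    ... | p , z = p , 𝟙¬≡0 (hit? ε p (ω p)) z
    conclude : (∃ λ p → Hit ε p (ω p)) → _
    conclude (p , (i , eqᵢ) , eqᵗ) = a , b , halves-distinct J-inj _ _ , goal
      where
      a = proj₁ (remQuot {h} h i) ↑ˡ h
      b = h ↑ʳ proj₂ (remQuot {h} h i)
      p≡ : p ≡ slot (J a) (J b)
      p≡ = trans (sym eqᵢ) (cong₂ slot (tuple≗ a) (tuple≗ b))
      goal : toℕ (ω (slot (J a) (J b))) ≡ target e (slot (J a) (J b))
      goal = subst₂ (λ i p → toℕ (ω p) ≡ target i p) index≡ p≡ eqᵗ

-- The lower bound

∑-𝟙≡0 : ∀ {A : Set} {P : A → Set} (P? : ∀ x → Dec (P x)) {xs} → All (λ x → ¬ P x) xs →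
        ∑ xs (λ x → 𝟙 (P? x)) ≡ 0
∑-𝟙≡0 P? []         = refl
∑-𝟙≡0 P? (¬p ∷ ¬ps) = cong₂ _+_ (𝟙-no (P? _) ¬p) (∑-𝟙≡0 P? ¬ps)

∑-exclusive≤1 : ∀ {A : Set} {P : A → Set} (P? : ∀ x → Dec (P x)) → (∀ {x y} → x ≢ y → P x → ¬ P y) →
                ∀ {xs} → Unique xs → ∑ xs (λ x → 𝟙 (P? x)) ≤ 1
∑-exclusive≤1 P? exclusive []                     = z≤n
∑-exclusive≤1 P? exclusive {x ∷ xs} (x∉xs ∷ xs!) with P? x
... | no  _ = ∑-exclusive≤1 P? exclusive xs!
... | yes p = ≤-reflexive (cong suc (∑-𝟙≡0 P? (All.map (λ x≢ → exclusive x≢ p) x∉xs)))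

∑-𝟙≤1 : ∀ {n} (c : Fin n) {xs} → Unique xs → ∑ xs (λ x → 𝟙 (c F.≟ x)) ≤ 1
∑-𝟙≤1 c = ∑-exclusive≤1 (c F.≟_) (λ { x≢y refl refl → x≢y refl })

-- Words with few agreements and digests of bits

agree : ∀ T {q} → (Fin T → Fin q) → (Fin T → Fin q) → ℕ
agree zero    x x′ = 0
agree (suc T) x x′ = 𝟙 (x zero F.≟ x′ zero) + agree T (x ∘ suc) (x′ ∘ suc)

agree-sym : ∀ T {q} (x x′ : Fin T → Fin q) → agree T x x′ ≡ agree T x′ x
agree-sym zero    x x′ = refl
agree-sym (suc T) x x′ = cong₂ _+_ head (agree-sym T (x ∘ suc) (x′ ∘ suc))
  where
  head : 𝟙 (x zero F.≟ x′ zero) ≡ 𝟙 (x′ zero F.≟ x zero)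
  head with x zero F.≟ x′ zero
  ... | yes p = sym (𝟙-yes (x′ zero F.≟ x zero) (sym p))
  ... | no ¬p = sym (𝟙-no (x′ zero F.≟ x zero) (¬p ∘ sym))

-- Words are added one at a time. For a random new word the expectation of `Q ^ agree` with a given
-- old word is at most `2 ^ T`, as each position contributes `(Q + q) / Q ≤ 2`. So some new word has
-- a sum over the `k` old words below `Q ^ s`, hence fewer than `s` agreements with each.
code : ∀ q T s k → k * 2 ^ T < suc q ^ s →
       ∃ λ (W : Fin k → Fin T → Fin (suc q)) → ∀ i j → i ≢ j → agree T (W i) (W j) < s
code q T s zero    _     = (λ ()) , λ ()
code q T s (suc k) small = ω V.∷ W , separated
  where
  open ≤-Reasoning
  Q = suc q
  instance _ = m^n≢0 Q T
  k-small : k * 2 ^ T < Q ^ s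
  k-small = ≤-<-trans (*-monoˡ-≤ (2 ^ T) (n≤1+n k)) small
  IH = code q T s k k-small
  W = proj₁ IH
  -- Weighting a new word by Q to the number of its agreements bounds all of these at once.
  g : Fin k → Fin T → Fin Q → ℕ
  g e j b = 1 + q * 𝟙 (W e j F.≟ b)
  chosen = derandomise (allFin k) q T (λ _ → 1) g
  ω = proj₁ chosen
  ∏g : ∀ T (w v : Fin T → Fin Q) → ∏ T (λ j → 1 + q * 𝟙 (w j F.≟ v j)) ≡ Q ^ agree T w v
  ∏g zero    w v = refl
  ∏g (suc T) w v with w zero F.≟ v zero
  ... | yes _ = cong₂ _*_ (cong suc (*-identityʳ q)) (∏g T (w ∘ suc) (v ∘ suc))
  ... | no  _ = trans (cong (λ z → (1 + z) * rest) (*-zeroʳ q))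
                      (trans (*-identityˡ rest) (∏g T (w ∘ suc) (v ∘ suc)))
    where rest = ∏ T (λ j → 1 + q * 𝟙 (w (suc j) F.≟ v (suc j)))
  ∑g : ∀ e j → ∑ (allFin Q) (g e j) ≤ 2 * Q
  ∑g e j = begin
    ∑ (allFin Q) (g e j)
      ≡⟨ ∑-+ (allFin Q) (λ _ → 1) _ ⟩
    ∑ (allFin Q) (λ _ → 1) + ∑ (allFin Q) (λ b → q * 𝟙 (W e j F.≟ b))
      ≡⟨ cong₂ _+_ (trans (∑-const (allFin Q) 1) (trans (*-identityʳ _) (length-allFin Q)))
                   (∑-* (allFin Q) q _) ⟩
    Q + q * ∑ (allFin Q) (λ b → 𝟙 (W e j F.≟ b))
      ≤⟨ +-monoʳ-≤ Q (*-mono-≤ (n≤1+n q) (∑-𝟙≤1 (W e j) (allFin⁺ Q))) ⟩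
    Q + Q * 1
      ≡⟨ cong (Q +_) (*-comm Q 1) ⟩
    2 * Q ∎
  total : ∑ (allFin k) (λ e → Q ^ agree T (W e) ω) ≤ k * 2 ^ T
  total = *-cancelˡ-≤ (Q ^ T) (begin
    Q ^ T * ∑ (allFin k) (λ e → Q ^ agree T (W e) ω)
      ≡⟨ cong (Q ^ T *_) (∑-cong (allFin k) (λ e → sym (trans (*-identityˡ _) (∏g T (W e) ω)))) ⟩
    Q ^ T * ∑ (allFin k) (λ e → 1 * ∏ T (λ j → g e j (ω j)))
      ≤⟨ proj₂ chosen ⟩
    ∑ (allFin k) (λ e → 1 * ∏ T (λ j → ∑ (allFin Q) (g e j)))
      ≤⟨ ∑-mono (allFin k) (λ e → ≤-trans (≤-reflexive (*-identityˡ _))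
           (≤-trans (∏-mono T (∑g e)) (≤-reflexive (∏-const T (2 * Q))))) ⟩
    ∑ (allFin k) (λ _ → (2 * Q) ^ T)
      ≡⟨ trans (∑-const (allFin k) _) (cong (_* (2 * Q) ^ T) (length-allFin k)) ⟩
    k * (2 * Q) ^ T
      ≡⟨ cong (k *_) (^-distribʳ-* T 2 Q) ⟩
    k * (2 ^ T * Q ^ T)
      ≡⟨ rotate k (2 ^ T) (Q ^ T) ⟩
    Q ^ T * (k * 2 ^ T) ∎)
    where
    rotate : ∀ a b c → a * (b * c) ≡ c * (a * b)
    rotate = solve-∀
  new : ∀ e → agree T (W e) ω < s
  new e = ≰⇒> λ s≤ → <-irrefl refl (begin-strict
    Q ^ s                                             ≤⟨ ^-monoʳ-≤ Q s≤ ⟩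
    Q ^ agree T (W e) ω                               ≤⟨ ∈⇒≤∑ _ (∈-allFin e) ⟩
    ∑ (allFin k) (λ e → Q ^ agree T (W e) ω)          ≤⟨ total ⟩
    k * 2 ^ T                                         <⟨ k-small ⟩
    Q ^ s                                             ∎)
  separated : ∀ i j → i ≢ j → agree T ((ω V.∷ W) i) ((ω V.∷ W) j) < s
  separated zero    zero    i≢j = contradiction refl i≢j
  separated zero    (suc j) i≢j = subst (_< s) (agree-sym T (W j) ω) (new j)
  separated (suc i) zero    i≢j = new i
  separated (suc i) (suc j) i≢j = proj₂ IH i j (i≢j ∘ cong suc)

-- The binary number, lowest digit first, of the bits of `y` at the positions where `x` and `x′`
-- agree. Other positions give no digit, so the range depends only on the number of agreements.
digest : ∀ T {q} (x x′ : Fin T → Fin q) → (Fin T → Fin 2) → ℕ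
digest zero    x x′ y = 0
digest (suc T) x x′ y with x zero F.≟ x′ zero
... | yes _ = toℕ (y zero) + 2 * digest T (x ∘ suc) (x′ ∘ suc) (y ∘ suc)
... | no  _ = digest T (x ∘ suc) (x′ ∘ suc) (y ∘ suc)

digest< : ∀ T {q} (x x′ : Fin T → Fin q) y → digest T x x′ y < 2 ^ agree T x x′
digest< zero    x x′ y = s≤s z≤n
digest< (suc T) x x′ y with x zero F.≟ x′ zero
... | no  _ = digest< T (x ∘ suc) (x′ ∘ suc) (y ∘ suc)
... | yes _ = begin-strict
  toℕ (y zero) + 2 * d  ≤⟨ +-monoˡ-≤ (2 * d) (Fₚ.toℕ≤pred[n] (y zero)) ⟩
  1 + 2 * d             <⟨ ≤-refl ⟩
  2 + 2 * d             ≡⟨ sym (*-suc 2 d) ⟩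
  2 * suc d             ≤⟨ *-monoʳ-≤ 2 (digest< T (x ∘ suc) (x′ ∘ suc) (y ∘ suc)) ⟩
  2 * 2 ^ agree T (x ∘ suc) (x′ ∘ suc) ∎
  where
  open ≤-Reasoning
  d = digest T (x ∘ suc) (x′ ∘ suc) (y ∘ suc)

bit-injective : ∀ (a b : Fin 2) m n → toℕ a + 2 * m ≡ toℕ b + 2 * n → a ≡ b × m ≡ n
bit-injective zero       zero       m n eq = refl , *-cancelˡ-≡ m n 2 eq
bit-injective (suc zero) (suc zero) m n eq = refl , *-cancelˡ-≡ m n 2 (suc-injective eq)
bit-injective zero       (suc zero) m n eq = contradiction eq (even≢odd m n)
bit-injective (suc zero) zero       m n eq = contradiction (sym eq) (even≢odd n m)

digest-injective : ∀ T {q} (x x′ : Fin T → Fin q) {y y′} → digest T x x′ y ≡ digest T x x′ y′ →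
                   ∀ j → x j ≡ x′ j → y j ≡ y′ j
digest-injective (suc T) x x′ {y} {y′} eq j xj≡ with x zero F.≟ x′ zero
digest-injective (suc T) x x′ eq zero    xj≡ | no x₀≢ = contradiction xj≡ x₀≢
digest-injective (suc T) x x′ {y} {y′} eq (suc j) xj≡ | no _   =
  digest-injective T (x ∘ suc) (x′ ∘ suc) {y ∘ suc} {y′ ∘ suc} eq j xj≡
digest-injective (suc T) x x′ {y} {y′} eq j xj≡ | yes _
    with bit-injective (y zero) (y′ zero)
           (digest T (x ∘ suc) (x′ ∘ suc) (y ∘ suc)) (digest T (x ∘ suc) (x′ ∘ suc) (y′ ∘ suc)) eq
digest-injective (suc T) x x′ eq zero    xj≡ | yes _ | y₀≡ , _   = y₀≡
digest-injective (suc T) x x′ {y} {y′} eq (suc j) xj≡ | yes _ | _   , eq′ =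
  digest-injective T (x ∘ suc) (x′ ∘ suc) {y ∘ suc} {y′ ∘ suc} eq′ j xj≡

funToFin-cong : ∀ {m} n {f g : Fin n → Fin m} → (∀ j → f j ≡ g j) → funToFin f ≡ funToFin g
funToFin-cong zero    f≗g = refl
funToFin-cong (suc n) f≗g = cong₂ combine (f≗g zero) (funToFin-cong n (f≗g ∘ suc))

finToFun-injective : ∀ {m} n {y y′ : Fin (m ^ n)} → (∀ j → finToFun y j ≡ finToFun {m} {n} y′ j) → y ≡ y′
finToFun-injective n {y} {y′} eq =
  trans (sym (Fₚ.funToFin-finToFin {n} y)) (trans (funToFin-cong n eq) (Fₚ.funToFin-finToFin {n} y′))

-- Colourings of the grid given by row and column rules

clique-in-line : ∀ {N n} (f : Fin n → Vertex N) → (∀ i j → i ≢ j → Adj (f i) (f j)) → 3 ≤ n →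
                 (∀ i j → proj₁ (f i) ≡ proj₁ (f j)) ⊎ (∀ i j → proj₂ (f i) ≡ proj₂ (f j))
clique-in-line {n = suc (suc (suc n))} f adj (s≤s (s≤s (s≤s _))) = choose (adj zero (suc zero) λ ())
  where
  choose : Adj (f zero) (f (suc zero)) → _
  choose (inj₁ (x≡ , y≢)) = inj₁ λ i j → trans (same i) (sym (same j))
    where
    same : ∀ i → proj₁ (f i) ≡ proj₁ (f zero)
    same zero          = refl
    same (suc zero)    = sym x≡
    same (suc (suc i)) with adj (suc (suc i)) zero (λ ()) | adj (suc (suc i)) (suc zero) (λ ())
    ... | inj₁ (p , _) | _            = p
    ... | inj₂ _       | inj₁ (q , _) = trans q (sym x≡)
    -- A vertex outside the row would share its column with both of the first two vertices, whose
    -- columns differ.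
    ... | inj₂ (_ , p) | inj₂ (_ , q) = contradiction (trans (sym p) q) y≢
  choose (inj₂ (x≢ , y≡)) = inj₂ λ i j → trans (same i) (sym (same j))
    where
    same : ∀ i → proj₂ (f i) ≡ proj₂ (f zero)
    same zero          = refl
    same (suc zero)    = sym y≡
    same (suc (suc i)) with adj (suc (suc i)) zero (λ ()) | adj (suc (suc i)) (suc zero) (λ ())
    ... | inj₂ (_ , p) | _            = p
    ... | inj₁ _       | inj₂ (_ , q) = trans q (sym y≡)
    ... | inj₁ (p , _) | inj₁ (q , _) = contradiction (trans (sym p) q) x≢

red≢blue : red ≢ blue
red≢blue ()

paint : ∀ {P : Set} → Dec P → Colour
paint (yes _) = red
paint (no  _) = blue

paint-red : ∀ {P : Set} (P? : Dec P) → P → paint P? ≡ red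
paint-red (yes _) _ = refl
paint-red (no ¬p) p = contradiction p ¬p

paint-red⁻¹ : ∀ {P : Set} (P? : Dec P) → paint P? ≡ red → P
paint-red⁻¹ (yes p) _ = p

-- `P` and `Q` will say that the first, respectively the second, coordinate is the same. The last
-- `blue` falls on pairs sharing no coordinate, whose colour is irrelevant.
pick : ∀ {P Q : Set} → Dec P → Dec Q → Colour → Colour → Colour
pick (yes _) _       c d = c
pick (no  _) (yes _) c d = d
pick (no  _) (no  _) c d = blue

pick-first : ∀ {P Q : Set} (P? : Dec P) (Q? : Dec Q) {c d} → P → pick P? Q? c d ≡ c
pick-first (yes _) _ _ = refl
pick-first (no ¬p) _ p = contradiction p ¬p

pick-second : ∀ {P Q : Set} (P? : Dec P) (Q? : Dec Q) {c d} → ¬ P → Q → pick P? Q? c d ≡ d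
pick-second (yes p) _       ¬p _ = contradiction p ¬p
pick-second (no  _) (yes _) _  _ = refl
pick-second (no  _) (no ¬q) _  q = contradiction q ¬q

-- The colours need to agree only in the case that uses them: the rule of row `x` can be replaced by
-- that of `x′` only when `x ≡ x′`.
pick-cong : ∀ {P P′ Q Q′ : Set} (P? : Dec P) (P′? : Dec P′) (Q? : Dec Q) (Q′? : Dec Q′) {c c′ d d′} →
            (P → P′) → (P′ → P) → (Q → Q′) → (Q′ → Q) →
            (P → c ≡ c′) → (Q → d ≡ d′) → pick P? Q? c d ≡ pick P′? Q′? c′ d′
pick-cong (yes p) (yes _)  _       _        _ _ _ _ c≡ _  = c≡ p
pick-cong (yes p) (no ¬p′) _       _        f _ _ _ _  _  = contradiction (f p) ¬p′
pick-cong (no ¬p) (yes p′) _       _        _ g _ _ _  _  = contradiction (g p′) ¬p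
pick-cong (no  _) (no  _)  (yes q) (yes _)  _ _ _ _ _  d≡ = d≡ q
pick-cong (no  _) (no  _)  (yes q) (no ¬q′) _ _ f _ _  _  = contradiction (f q) ¬q′
pick-cong (no  _) (no  _)  (no ¬q) (yes q′) _ _ _ g _  _  = contradiction (g q′) ¬q
pick-cong (no  _) (no  _)  (no  _) (no  _)  _ _ _ _ _  _  = refl

module Grid (N : ℕ) (RowRed ColumnRed : Fin N → Fin (N * N) → Set)
  (rowRed? : ∀ x p → Dec (RowRed x p)) (columnRed? : ∀ y p → Dec (ColumnRed y p))
  (no-red-rectangle : ∀ {x x′ y y′ : Fin N} → y ≢ y′ → RowRed x (slot y y′) → RowRed x′ (slot y y′) →
                      ColumnRed y (slot x x′) → ¬ ColumnRed y′ (slot x x′))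
  (h : ℕ)
  (row-hits : ∀ x (J : Fin (h + h) → Fin N) → Inj J →
              ∃ λ a → ∃ λ b → J a ≢ J b × RowRed x (slot (J a) (J b)))
  (column-hits : ∀ y (J : Fin (h + h) → Fin N) → Inj J →
                 ∃ λ a → ∃ λ b → J a ≢ J b × ColumnRed y (slot (J a) (J b))) where

  edge : Vertex N → Vertex N → Colour
  edge (x , y) (x′ , y′) = pick (x F.≟ x′) (y F.≟ y′)
    (paint (rowRed? x (slot y y′))) (paint (columnRed? y (slot x x′)))

  edge-sym : ∀ u v → edge u v ≡ edge v u
  edge-sym (x , y) (x′ , y′) = pick-cong (x F.≟ x′) (x′ F.≟ x) (y F.≟ y′) (y′ F.≟ y) sym sym sym sym
    (λ { refl → cong (λ p → paint (rowRed? x p)) (slot-sym y y′) })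
    (λ { refl → cong (λ p → paint (columnRed? y p)) (slot-sym x x′) })

  edge-row : ∀ x y y′ → edge (x , y) (x , y′) ≡ paint (rowRed? x (slot y y′))
  edge-row x y y′ = pick-first (x F.≟ x) (y F.≟ y′) refl

  edge-column : ∀ x x′ y → x ≢ x′ → edge (x , y) (x′ , y) ≡ paint (columnRed? y (slot x x′))
  edge-column x x′ y x≢x′ = pick-second (x F.≟ x′) (y F.≟ y) x≢x′ refl

  -- The lower bound has to refute every side `N₀` up to `N`, so the colouring is restricted along
  -- an inclusion. Since `h + h ≤ n`, a blue clique on `n` vertices contains a tuple to which
  -- `row-hits` or `column-hits` applies.
  module _ (N₀ : ℕ) (N₀≤N : N₀ ≤ N) (n : ℕ) (h+h≤n : h + h ≤ n) (3≤n : 3 ≤ n) where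

    private
      ι : Fin N₀ → Fin N
      ι x = inject≤ x N₀≤N

      ι-injective : ∀ {x y} → ι x ≡ ι y → x ≡ y
      ι-injective = Fₚ.inject≤-injective N₀≤N N₀≤N _ _

    restricted : Colouring N₀
    restricted = record
      { col  = λ (x , y) (x′ , y′) → edge (ι x , ι y) (ι x′ , ι y′)
      ; symm = λ (x , y) (x′ , y′) → edge-sym (ι x , ι y) (ι x′ , ι y′)
      }

    no-rectangle : ¬ RedRectangle restricted
    no-rectangle (x , x′ , y , y′ , x≢x′ , y≢y′ , r , c′ , r′ , c) =
      no-red-rectangle (y≢y′ ∘ ι-injective)
        (paint-red⁻¹ (rowRed? _ _) (trans (sym (edge-row (ι x) (ι y) (ι y′))) r))
        (subst (RowRed (ι x′)) (slot-sym (ι y′) (ι y))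
          (paint-red⁻¹ (rowRed? _ _) (trans (sym (edge-row (ι x′) (ι y′) (ι y))) r′)))
        (subst (ColumnRed (ι y)) (slot-sym (ι x′) (ι x))
          (paint-red⁻¹ (columnRed? _ _)
            (trans (sym (edge-column (ι x′) (ι x) (ι y) (x≢x′ ∘ sym ∘ ι-injective))) c)))
        (paint-red⁻¹ (columnRed? _ _)
          (trans (sym (edge-column (ι x) (ι x′) (ι y′) (x≢x′ ∘ ι-injective))) c′))

    no-clique : ¬ BlueClique restricted n
    no-clique (f , f-inj , blue-edges)
        with clique-in-line f (λ i j i≢j → proj₁ (blue-edges i j i≢j)) 3≤n
    ... | inj₁ same-row = absurd (row-hits (ι (proj₁ (f i₀))) J J-inj)
      where
      i₀ : Fin n
      i₀ = F.fromℕ< (≤-trans (s≤s z≤n) 3≤n)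
      κ : Fin (h + h) → Fin n
      κ a = inject≤ a h+h≤n
      J : Fin (h + h) → Fin N
      J a = ι (proj₂ (f (κ a)))
      J-inj : Inj J
      J-inj a b eq = Fₚ.inject≤-injective h+h≤n h+h≤n a b
        (f-inj (κ a) (κ b) (cong₂ _,_ (same-row (κ a) (κ b)) (ι-injective eq)))
      absurd : (∃ λ a → ∃ λ b → J a ≢ J b × RowRed (ι (proj₁ (f i₀))) (slot (J a) (J b))) → _
      absurd (a , b , Ja≢Jb , hit) = red≢blue (trans (sym is-red)
        (subst (λ x → edge (ι (proj₁ (f (κ a))) , J a) (ι x , J b) ≡ blue) (same-row (κ b) (κ a))
          (proj₂ (blue-edges (κ a) (κ b) λ eq → Ja≢Jb (cong (λ k → ι (proj₂ (f k))) eq)))))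
        where
        is-red : edge (ι (proj₁ (f (κ a))) , J a) (ι (proj₁ (f (κ a))) , J b) ≡ red
        is-red = trans (edge-row _ (J a) (J b))
          (paint-red (rowRed? _ _) (subst (λ x → RowRed (ι x) (slot (J a) (J b))) (same-row i₀ (κ a)) hit))
    ... | inj₂ same-column = absurd (column-hits (ι (proj₂ (f i₀))) J J-inj)
      where
      i₀ : Fin n
      i₀ = F.fromℕ< (≤-trans (s≤s z≤n) 3≤n)
      κ : Fin (h + h) → Fin n
      κ a = inject≤ a h+h≤n
      J : Fin (h + h) → Fin N
      J a = ι (proj₁ (f (κ a)))
      J-inj : Inj J
      J-inj a b eq = Fₚ.inject≤-injective h+h≤n h+h≤n a b
        (f-inj (κ a) (κ b) (cong₂ _,_ (ι-injective eq) (same-column (κ a) (κ b))))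
      absurd : (∃ λ a → ∃ λ b → J a ≢ J b × ColumnRed (ι (proj₂ (f i₀))) (slot (J a) (J b))) → _
      absurd (a , b , Ja≢Jb , hit) = red≢blue (trans (sym is-red)
        (subst (λ y → edge (J a , ι (proj₂ (f (κ a)))) (J b , ι y) ≡ blue) (same-column (κ b) (κ a))
          (proj₂ (blue-edges (κ a) (κ b) λ eq → Ja≢Jb (cong (λ k → ι (proj₁ (f k))) eq)))))
        where
        is-red : edge (J a , ι (proj₂ (f (κ a)))) (J b , ι (proj₂ (f (κ a)))) ≡ red
        is-red = trans (edge-column (J a) (J b) _ Ja≢Jb)
          (paint-red (columnRed? _ _)
            (subst (λ y → ColumnRed (ι y) (slot (J a) (J b))) (same-column i₀ (κ a)) hit))

    not-arrows : ¬ GrArrows N₀ n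
    not-arrows arrows with arrows restricted
    ... | inj₁ rectangle = no-rectangle rectangle
    ... | inj₂ clique    = no-clique clique

-- The colouring built from words and bits

module Construction (T′ s K h : ℕ)
  -- Letters and digests then fit the same range, so the one hypothesis `colours-fit` serves rows
  -- and columns.
  (K+1≡2^s : suc K ≡ 2 ^ s)
  (code-fits : 2 ^ suc T′ * 2 ^ suc T′ < suc K ^ s)
  (colours-fit : 2 ^ suc T′ * (2 ^ suc T′) ^ (h + h) * K ^ (h * h) < suc K ^ (h * h)) where

  T N : ℕ
  T = suc T′
  N = 2 ^ T

  word : Fin N → Fin T → Fin (suc K)
  word = proj₁ (code K T s N code-fits)

  bits : Fin N → Fin T → Fin 2
  bits = finToFun

  differ : Fin N × Fin N → Fin T
  differ (y , y′) with Fₚ.any? (λ j → ¬? (bits y j F.≟ bits y′ j))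
  ... | yes (j , _) = j
  -- Default for equal `y` and `y′`; a position exists because `T` is `suc T′`.
  ... | no  _       = zero

  bits-differ : ∀ y y′ → y ≢ y′ → bits y (differ (y , y′)) ≢ bits y′ (differ (y , y′))
  bits-differ y y′ y≢y′ with Fₚ.any? (λ j → ¬? (bits y j F.≟ bits y′ j))
  ... | yes (_ , p) = p
  ... | no  ¬∃      = contradiction
    (finToFun-injective T λ j → decidable-stable (bits y j F.≟ bits y′ j) λ ne → ¬∃ (j , ne)) y≢y′

  differ-slot : ∀ y y′ → y ≢ y′ → let j = differ (ends (slot y y′)) in bits y j ≢ bits y′ j
  differ-slot y y′ y≢y′ = ends-slot-elim (λ e → bits y (differ e) ≢ bits y′ (differ e)) y y′
    (bits-differ y y′ y≢y′) (bits-differ y′ y (y≢y′ ∘ sym) ∘ sym)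

  rowTarget : Fin N → Fin (N * N) → ℕ
  rowTarget x p = toℕ (word x (differ (ends p)))

  columnTarget : Fin N → Fin (N * N) → ℕ
  columnTarget y p = digest T (word (proj₁ (ends p))) (word (proj₂ (ends p))) (bits y)

  -- Fewer than `s` agreements keep the digest below `2 ^ s`, which makes it a possible random
  -- value.
  digest≤K : ∀ u v y → u ≢ v → digest T (word u) (word v) y ≤ K
  digest≤K u v y u≢v = ≤-pred (begin-strict
    digest T (word u) (word v) y     <⟨ digest< T (word u) (word v) y ⟩
    2 ^ agree T (word u) (word v)    ≤⟨ ^-monoʳ-≤ 2 (<⇒≤ (proj₂ (code K T s N code-fits) u v u≢v)) ⟩
    2 ^ s                            ≡⟨ sym K+1≡2^s ⟩
    suc K                            ∎)
    where open ≤-Reasoning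

  columnTarget≤K : ∀ y u v → u ≢ v → columnTarget y (slot u v) ≤ K
  columnTarget≤K y u v u≢v =
    ends-slot-elim (λ (u , v) → digest T (word u) (word v) (bits y) ≤ K) u v
      (digest≤K u v (bits y) u≢v) (digest≤K v u (bits y) (u≢v ∘ sym))

  module Row = Hitting N N K h rowTarget
    (λ x y y′ _ → Fₚ.toℕ≤pred[n] (word x (differ (ends (slot y y′))))) colours-fit
  module Column = Hitting N N K h columnTarget columnTarget≤K colours-fit

  RowRed : Fin N → Fin (N * N) → Set
  RowRed x p = toℕ (Row.ω p) ≡ rowTarget x p

  ColumnRed : Fin N → Fin (N * N) → Set
  ColumnRed y p = toℕ (Column.ω p) ≡ columnTarget y p

  -- The two red row edges name the same letter, so the words agree at `j`; the two red column edges
  -- name the same digest, so `y` and `y′` have equal bits at `j`. But `j` was chosen as a position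
  -- of difference.
  no-red-rectangle : ∀ {x x′ y y′} → y ≢ y′ → RowRed x (slot y y′) → RowRed x′ (slot y y′) →
                     ColumnRed y (slot x x′) → ¬ ColumnRed y′ (slot x x′)
  no-red-rectangle {x} {x′} {y} {y′} y≢y′ r r′ c c′ = differ-slot y y′ y≢y′ (bits≡ (ends-slot x x′))
    where
    j = differ (ends (slot y y′))
    word≡ : word x j ≡ word x′ j
    word≡ = Fₚ.toℕ-injective (trans (sym r) r′)
    digest≡ : columnTarget y (slot x x′) ≡ columnTarget y′ (slot x x′)
    digest≡ = trans (sym c) c′
    SameDigest : Fin N × Fin N → Set
    SameDigest (u , v) = digest T (word u) (word v) (bits y) ≡ digest T (word u) (word v) (bits y′)
    bits≡ : ends (slot x x′) ≡ (x , x′) ⊎ ends (slot x x′) ≡ (x′ , x) → bits y j ≡ bits y′ j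
    bits≡ (inj₁ eq) = digest-injective T (word x) (word x′) (subst SameDigest eq digest≡) j word≡
    bits≡ (inj₂ eq) = digest-injective T (word x′) (word x) (subst SameDigest eq digest≡) j (sym word≡)

  rowRed? : ∀ x p → Dec (RowRed x p)
  rowRed? x p = toℕ (Row.ω p) ≟ rowTarget x p

  columnRed? : ∀ y p → Dec (ColumnRed y p)
  columnRed? y p = toℕ (Column.ω p) ≟ columnTarget y p

  open Grid N RowRed ColumnRed rowRed? columnRed? no-red-rectangle h Row.hits Column.hits public
    using (not-arrows)

-- Estimates and parameters for the lower bound

bernoulli : ∀ j i → j ^ suc i + suc i * j ^ i ≤ suc j ^ suc i
bernoulli j zero    = ≤-reflexive (base j)
  where
  base : ∀ j → j * 1 + 1 ≡ suc (j * 1)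
  base = solve-∀
bernoulli j (suc i) = begin
  j * (j * j ^ i) + suc (suc i) * (j * j ^ i)
    ≤⟨ m≤m+n _ (suc i * j ^ i) ⟩
  j * (j * j ^ i) + suc (suc i) * (j * j ^ i) + suc i * j ^ i
    ≡⟨ expand j i (j ^ i) ⟩
  suc j * (j * j ^ i + suc i * j ^ i)
    ≤⟨ *-monoʳ-≤ (suc j) (bernoulli j i) ⟩
  suc j * suc j ^ suc i ∎
  where
  open ≤-Reasoning
  expand : ∀ j i p → j * (j * p) + (2 + i) * (j * p) + (1 + i) * p ≡ (1 + j) * (j * p + (1 + i) * p)
  expand = solve-∀

-- The inequality `(1 + 1 / K) ^ (K + 1) ≥ 2` without fractions, from the first two terms of the
-- binomial expansion.
twice-power : ∀ K → 2 * K ^ suc K ≤ suc K ^ suc K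
twice-power K = begin
  2 * K ^ suc K                       ≡⟨ cong (K ^ suc K +_) (+-identityʳ _) ⟩
  K ^ suc K + K * K ^ K               ≤⟨ +-monoʳ-≤ (K ^ suc K) (*-monoˡ-≤ (K ^ K) (n≤1+n K)) ⟩
  K ^ suc K + suc K * K ^ K           ≤⟨ bernoulli K K ⟩
  suc K ^ suc K                       ∎
  where open ≤-Reasoning

power-gap : ∀ K g → 2 ^ g * K ^ (suc K * g) ≤ suc K ^ (suc K * g)
power-gap K g = begin
  2 ^ g * K ^ (suc K * g)      ≡⟨ cong (2 ^ g *_) (sym (^-*-assoc K (suc K) g)) ⟩
  2 ^ g * (K ^ suc K) ^ g      ≡⟨ sym (^-distribʳ-* g 2 (K ^ suc K)) ⟩
  (2 * K ^ suc K) ^ g          ≤⟨ ^-monoˡ-≤ g (twice-power K) ⟩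
  (suc K ^ suc K) ^ g          ≡⟨ ^-*-assoc (suc K) (suc K) g ⟩
  suc K ^ (suc K * g)          ∎
  where open ≤-Reasoning

-- With this `h`, the square `h * h` is `suc K * g` for `g = 4 * T * h`, so `power-gap` gains
-- `2 ^ g`. There are `2 ^ (T * (1 + 2 * h))` events, and `1 + 2 * h < 4 * h`.
colours-fit : ∀ T K → 1 ≤ T → 1 ≤ K → let h = suc K * (4 * T) in
              2 ^ T * (2 ^ T) ^ (h + h) * K ^ (h * h) < suc K ^ (h * h)
colours-fit T K 1≤T 1≤K = begin-strict
  2 ^ T * (2 ^ T) ^ (h + h) * K ^ (h * h)
    ≡⟨ cong (_* K ^ (h * h)) (^-*-assoc 2 T (1 + (h + h))) ⟩
  2 ^ (T * (1 + (h + h))) * K ^ (h * h)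
    <⟨ *-monoˡ-< (K ^ (h * h)) (^-monoʳ-< 2 ≤-refl exponent) ⟩
  2 ^ g * K ^ (h * h)
    ≡⟨ cong (λ e → 2 ^ g * K ^ e) h*h≡ ⟩
  2 ^ g * K ^ (suc K * g)
    ≤⟨ power-gap K g ⟩
  suc K ^ (suc K * g)
    ≡⟨ cong (suc K ^_) (sym h*h≡) ⟩
  suc K ^ (h * h) ∎
  where
  open ≤-Reasoning
  h = suc K * (4 * T)
  g = suc K * (4 * T * (4 * T))
  instance
    _ = >-nonZero 1≤K
    _ = >-nonZero 1≤T
    _ = m^n≢0 K (h * h)
  h*h≡ : h * h ≡ suc K * g
  h*h≡ = identity (suc K) T
    where
    identity : ∀ Q T → (Q * (4 * T)) * (Q * (4 * T)) ≡ Q * (Q * (4 * T * (4 * T)))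
    identity = solve-∀
  2≤h : 2 ≤ h
  2≤h = *-mono-≤ (s≤s (z≤n {K})) (*-mono-≤ {2} {4} (s≤s (s≤s z≤n)) 1≤T)
  exponent : T * (1 + (h + h)) < g
  exponent = begin-strict
    T * (1 + (h + h))
      <⟨ *-monoʳ-< T (+-monoˡ-< (h + h) (≤-trans 2≤h (m≤m+n h h))) ⟩
    T * ((h + h) + (h + h))
      ≡⟨ identity (suc K) T ⟩
    g ∎
    where
    identity : ∀ Q T → T * ((Q * (4 * T) + Q * (4 * T)) + (Q * (4 * T) + Q * (4 * T))) ≡ Q * (4 * T * (4 * T))
    identity = solve-∀

n<2^n : ∀ n → n < 2 ^ n
n<2^n zero    = s≤s z≤n
n<2^n (suc n) = begin-strict
  1 + n            <⟨ +-mono-≤-< (m^n>0 2 n) (n<2^n n) ⟩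
  2 ^ n + 2 ^ n    ≡⟨ cong (2 ^ n +_) (sym (+-identityʳ _)) ⟩
  2 ^ suc n        ∎
  where open ≤-Reasoning

-- The parameters are `T = k * k`, `s = 2 * k` and `suc K = 2 ^ (2 * k)`. The code needs
-- `2 ^ (2 * k * k)` below `2 ^ (4 * k * k)`, and `h + h = 8 * 2 ^ (2 * k) * k * k` is at most
-- `2 ^ (7 * k)` by `k < 2 ^ k`.
grid-ramsey-lower : ∀ k n → 1 ≤ k → 2 ^ (7 * k) ≤ n → ∀ N → GrArrows N n → 2 ^ (k * k) < N
grid-ramsey-lower k@(suc k′) n 1≤k n-large N arrows = ≰⇒> λ N≤ →
  -- The first argument is the predecessor of `k * k`.
  Construction.not-arrows (k′ + k′ * k) (2 * k) K h Q≡ code-fits (colours-fit T K (s≤s z≤n) 1≤K)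
    N N≤ n h+h≤n (≤-trans (s≤s (s≤s (s≤s z≤n))) (≤-trans 8≤h+h h+h≤n)) arrows
  where
  open ≤-Reasoning
  T = k * k
  K = pred (2 ^ (2 * k))
  h = suc K * (4 * T)
  Q≡ : suc K ≡ 2 ^ (2 * k)
  Q≡ = suc-pred (2 ^ (2 * k)) {{m^n≢0 2 (2 * k)}}
  2≤2k : 2 ≤ 2 * k
  2≤2k = *-monoʳ-≤ 2 1≤k
  1≤K : 1 ≤ K
  1≤K = ≤-pred (begin
    2              ≤⟨ ^-monoʳ-≤ 2 (≤-trans (s≤s z≤n) 2≤2k) ⟩
    2 ^ (2 * k)    ≡⟨ sym Q≡ ⟩
    suc K          ∎)
  code-fits : 2 ^ T * 2 ^ T < suc K ^ (2 * k)
  code-fits = begin-strict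
    2 ^ T * 2 ^ T              ≡⟨ sym (^-distribˡ-+-* 2 T T) ⟩
    2 ^ (T + T)                <⟨ ^-monoʳ-< 2 ≤-refl (m<m+n (T + T) (s≤s z≤n)) ⟩
    2 ^ ((T + T) + (T + T))    ≡⟨ cong (2 ^_) (identity k) ⟩
    2 ^ (2 * k * (2 * k))      ≡⟨ sym (^-*-assoc 2 (2 * k) (2 * k)) ⟩
    (2 ^ (2 * k)) ^ (2 * k)    ≡⟨ cong (_^ (2 * k)) (sym Q≡) ⟩
    suc K ^ (2 * k)            ∎
    where
    identity : ∀ k → (k * k + k * k) + (k * k + k * k) ≡ 2 * k * (2 * k)
    identity = solve-∀
  8≤h+h : 8 ≤ h + h
  8≤h+h = +-mono-≤ 4≤h 4≤h
    where
    4≤h : 4 ≤ h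
    4≤h = *-mono-≤ (s≤s (z≤n {K})) (*-monoʳ-≤ 4 {1} {T} (s≤s z≤n))
  h+h≤n : h + h ≤ n
  h+h≤n = begin
    h + h
      ≡⟨ identity (suc K) k ⟩
    2 ^ 3 * (suc K * (k * k))
      ≤⟨ *-monoʳ-≤ (2 ^ 3) (*-mono-≤ (≤-reflexive Q≡) (*-mono-≤ (<⇒≤ (n<2^n k)) (<⇒≤ (n<2^n k)))) ⟩
    2 ^ 3 * (2 ^ (2 * k) * (2 ^ k * 2 ^ k))
      ≡⟨ cong (λ z → 2 ^ 3 * (2 ^ (2 * k) * z)) (sym (^-distribˡ-+-* 2 k k)) ⟩
    2 ^ 3 * (2 ^ (2 * k) * 2 ^ (k + k))
      ≡⟨ cong (2 ^ 3 *_) (sym (^-distribˡ-+-* 2 (2 * k) (k + k))) ⟩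
    2 ^ 3 * 2 ^ (2 * k + (k + k))
      ≡⟨ sym (^-distribˡ-+-* 2 3 (2 * k + (k + k))) ⟩
    2 ^ (3 + (2 * k + (k + k)))
      ≤⟨ ^-monoʳ-≤ 2 (+-monoˡ-≤ (2 * k + (k + k)) (*-monoʳ-≤ 3 1≤k)) ⟩
    2 ^ (3 * k + (2 * k + (k + k)))
      ≡⟨ cong (2 ^_) (identity′ k) ⟩
    2 ^ (7 * k)
      ≤⟨ n-large ⟩
    n ∎
    where
    identity : ∀ Q k → Q * (4 * (k * k)) + Q * (4 * (k * k)) ≡ 8 * (Q * (k * k))
    identity = solve-∀
    identity′ : ∀ k → 3 * k + (2 * k + (k + k)) ≡ 7 * k
    identity′ = solve-∀

-- In a grid of side at most 1 the all-red colouring has neither a rectangle nor two vertices for a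
-- clique. This serves the `n` whose logarithm is below 7.
2≤GrArrows : ∀ n N → 2 ≤ n → GrArrows N n → 2 ≤ N
2≤GrArrows n (suc (suc N)) _ _ = s≤s (s≤s z≤n)
2≤GrArrows n zero (s≤s _) arrows with arrows (record { col = λ _ _ → red ; symm = λ _ _ → refl })
... | inj₁ (() , _)
... | inj₂ (f , _) with proj₁ (f zero)
...   | ()
2≤GrArrows n (suc zero) (s≤s (s≤s _)) arrows
    with arrows (record { col = λ _ _ → red ; symm = λ _ _ → refl })
... | inj₁ (zero , zero , _ , _ , x≢x′ , _) = contradiction refl x≢x′
... | inj₂ (f , f-inj , _) with f zero in eq₀ | f (suc zero) in eq₁
...   | zero , zero | zero , zero with f-inj zero (suc zero) (trans eq₀ (sym eq₁))
...     | ()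

2^⌊log₂n⌋≤n : ∀ n → 1 ≤ n → 2 ^ ⌊log₂ n ⌋ ≤ n
2^⌊log₂n⌋≤n = <-rec _ step
  where
  open ≤-Reasoning
  step : ∀ n → (∀ {m} → m < n → 1 ≤ m → 2 ^ ⌊log₂ m ⌋ ≤ m) → 1 ≤ n → 2 ^ ⌊log₂ n ⌋ ≤ n
  step 1                 _   _ = ≤-refl
  step n@(suc (suc n′)) rec _ = begin
    2 ^ ⌊log₂ n ⌋              ≤⟨ ^-monoʳ-≤ 2 (m≤n+m∸n ⌊log₂ n ⌋ 1) ⟩
    2 * 2 ^ (⌊log₂ n ⌋ ∸ 1)    ≡⟨ cong (λ e → 2 * 2 ^ e) (sym (⌊log₂⌊n/2⌋⌋≡⌊log₂n⌋∸1 n)) ⟩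
    2 * 2 ^ ⌊log₂ ⌊ n /2⌋ ⌋    ≤⟨ *-monoʳ-≤ 2 (rec (⌊n/2⌋<n (suc n′)) (s≤s z≤n)) ⟩
    2 * ⌊ n /2⌋                ≡⟨ cong (⌊ n /2⌋ +_) (+-identityʳ _) ⟩
    ⌊ n /2⌋ + ⌊ n /2⌋          ≤⟨ +-monoʳ-≤ ⌊ n /2⌋ (⌊n/2⌋≤⌈n/2⌉ n) ⟩
    ⌊ n /2⌋ + ⌈ n /2⌉          ≡⟨ ⌊n/2⌋+⌈n/2⌉≡n n ⟩
    n                          ∎

n≤2^⌈log₂n⌉ : ∀ n → n ≤ 2 ^ ⌈log₂ n ⌉
n≤2^⌈log₂n⌉ = <-rec _ step
  where
  open ≤-Reasoning
  step : ∀ n → (∀ {m} → m < n → m ≤ 2 ^ ⌈log₂ m ⌉) → n ≤ 2 ^ ⌈log₂ n ⌉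
  step 0                 _   = z≤n
  step 1                 _   = ≤-refl
  step n@(suc (suc n′)) rec = begin
    n                          ≡⟨ sym (⌊n/2⌋+⌈n/2⌉≡n n) ⟩
    ⌊ n /2⌋ + ⌈ n /2⌉          ≤⟨ +-monoˡ-≤ ⌈ n /2⌉ (⌊n/2⌋≤⌈n/2⌉ n) ⟩
    ⌈ n /2⌉ + ⌈ n /2⌉          ≡⟨ cong (⌈ n /2⌉ +_) (sym (+-identityʳ _)) ⟩
    2 * ⌈ n /2⌉                ≤⟨ *-monoʳ-≤ 2 (rec (⌈n/2⌉<n n′)) ⟩
    2 * 2 ^ ⌈log₂ ⌈ n /2⌉ ⌉    ≡⟨ cong (λ e → 2 * 2 ^ e) (⌈log₂⌈n/2⌉⌉≡⌈log₂n⌉∸1 n) ⟩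
    2 ^ (1 + (⌈log₂ n ⌉ ∸ 1))  ≡⟨ cong (2 ^_) (m+[n∸m]≡n (⌈log₂⌉-mono-≤ {2} {n} (s≤s (s≤s z≤n)))) ⟩
    2 ^ ⌈log₂ n ⌉              ∎

-- For L = ⌊log₂ n⌋ ≥ 7 and k = L / 7 one has L ≤ 14 k, and 196 = 14 · 14.
lower-bound : ∀ b → 196 ≤ b → ∀ n → 2 ≤ n → ∀ N → GrArrows N n →
              2 ^ (1 * (⌊log₂ n ⌋ * ⌊log₂ n ⌋)) ≤ N ^ b
lower-bound b 196≤b n 2≤n N arrows = by-size (L / 7) refl
  where
  open ≤-Reasoning
  L = ⌊log₂ n ⌋
  L≤ : ∀ k → L / 7 ≡ k → L ≤ 7 * suc k
  L≤ k eq = begin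
    L                    ≡⟨ m≡m%n+[m/n]*n L 7 ⟩
    L % 7 + L / 7 * 7    ≤⟨ +-mono-≤ (<⇒≤ (m%n<n L 7)) (≤-reflexive (trans (cong (_* 7) eq) (*-comm k 7))) ⟩
    7 + 7 * k            ≡⟨ sym (*-suc 7 k) ⟩
    7 * suc k            ∎
  7k≤L : ∀ k → L / 7 ≡ k → 7 * k ≤ L
  7k≤L k eq = ≤-trans (≤-reflexive (trans (*-comm 7 k) (cong (_* 7) (sym eq)))) (m/n*n≤m L 7)
  by-size : ∀ k → L / 7 ≡ k → 2 ^ (1 * (L * L)) ≤ N ^ b
  -- Here `L ≤ 7`, and the exponent is at most 49, below `196 = 49 + 147`, so `2 ≤ N` suffices.
  by-size zero eq = begin
    2 ^ (1 * (L * L))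
      ≤⟨ ^-monoʳ-≤ 2 (≤-trans (*-monoʳ-≤ 1 (*-mono-≤ (L≤ 0 eq) (L≤ 0 eq))) (≤-trans (m≤m+n 49 147) 196≤b)) ⟩
    2 ^ b
      ≤⟨ ^-monoˡ-≤ b (2≤GrArrows n N 2≤n arrows) ⟩
    N ^ b ∎
  by-size k@(suc k′) eq = begin
    2 ^ (1 * (L * L))
      ≤⟨ ^-monoʳ-≤ 2 exponent ⟩
    2 ^ (k * k * b)
      ≡⟨ sym (^-*-assoc 2 (k * k) b) ⟩
    (2 ^ (k * k)) ^ b
      ≤⟨ ^-monoˡ-≤ b (<⇒≤ (grid-ramsey-lower k n (s≤s z≤n) n-large N arrows)) ⟩
    N ^ b ∎
    where
    n-large : 2 ^ (7 * k) ≤ n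
    n-large = ≤-trans (^-monoʳ-≤ 2 (7k≤L k eq)) (2^⌊log₂n⌋≤n n (≤-trans (s≤s z≤n) 2≤n))
    L≤7[k+k] : L ≤ 7 * (k + k)
    L≤7[k+k] = ≤-trans (L≤ k eq) (*-monoʳ-≤ 7 (+-monoˡ-≤ k {1} {k} (s≤s z≤n)))
    identity : ∀ c k → 1 * (c * (k + k) * (c * (k + k))) ≡ k * k * (4 * (c * c))
    identity = solve-∀
    exponent : 1 * (L * L) ≤ k * k * b
    exponent = begin
      1 * (L * L)                            ≤⟨ *-monoʳ-≤ 1 (*-mono-≤ L≤7[k+k] L≤7[k+k]) ⟩
      1 * (7 * (k + k) * (7 * (k + k)))      ≡⟨ identity 7 k ⟩
      k * k * 196                            ≤⟨ *-monoʳ-≤ (k * k) 196≤b ⟩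
      k * k * b                              ∎

-- Ramsey numbers and pigeonholing on lists

AllPairs-resp-⊆ : ∀ {R : A → A → Set} {xs ys} → xs ⊆ ys → AllPairs R ys → AllPairs R xs
AllPairs-resp-⊆ []           []       = []
AllPairs-resp-⊆ (y ∷ʳ s)     (_ ∷ ps) = AllPairs-resp-⊆ s ps
AllPairs-resp-⊆ (refl ∷ s)   (p ∷ ps) = All-resp-⊆ s p ∷ AllPairs-resp-⊆ s ps

separate : ∀ {P Q : A → Set} {zs} → All (λ z → P z ⊎ Q z) zs →
           ∃ λ xs → ∃ λ ys → xs ⊆ zs × ys ⊆ zs × All P xs × All Q ys × length zs ≡ length xs + length ys
separate []                   = [] , [] , [] , [] , [] , [] , refl
separate (inj₁ p ∷ pqs) with separate pqs
... | xs , ys , s , t , ps , qs , eq = _ ∷ xs , ys , refl ∷ s , _ ∷ʳ t , p ∷ ps , qs , cong suc eq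
separate (inj₂ q ∷ pqs) with separate pqs
... | xs , ys , s , t , ps , qs , eq =
  xs , _ ∷ ys , _ ∷ʳ s , refl ∷ t , ps , q ∷ qs , trans (cong suc eq) (sym (+-suc (length xs) _))

Clique : (A → A → Set) → ℕ → List A → Set
Clique R k xs = ∃ λ ys → ys ⊆ xs × k ≤ length ys × AllPairs R ys

-- `a` counts the vertices still wanted for the clique of `R`. If `x` has `n ^ suc t` neighbours in
-- `B`, the bound for `t` applies to them and `x` extends a clique of `B`. Otherwise `x` joins the
-- clique of `R`, and its `R`-neighbours suffice for `a` lowered by one.
ramsey-step : ∀ {R B : A → A → Set} n t →
  (∀ xs → AllPairs (λ x y → R x y ⊎ B x y) xs → n ^ suc t ≤ length xs → Clique R n xs ⊎ Clique B (suc t) xs) →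
  ∀ a xs → AllPairs (λ x y → R x y ⊎ B x y) xs → a ≤ n → a * n ^ suc t ≤ length xs →
  Clique R a xs ⊎ Clique B (2 + t) xs
ramsey-step n t IH zero xs _ _ _ = inj₁ ([] , minimum xs , z≤n , [])
ramsey-step (suc n) t IH (suc a) [] _ _ large =
  contradiction (≤-trans (m≤m+n (suc n ^ suc t) (a * suc n ^ suc t)) large) (<⇒≱ (m^n>0 (suc n) (suc t)))
ramsey-step n t IH (suc a) (x ∷ xs) (px ∷ pxs) a<n large with separate px
... | ys , zs , ys⊆ , zs⊆ , Rys , Bzs , eq with n ^ suc t ≤? length zs
... | yes zs-large with IH zs (AllPairs-resp-⊆ zs⊆ pxs) zs-large
...   | inj₁ (q , q⊆ , n≤ , Rq) = inj₁ (q , x ∷ʳ ⊆-trans q⊆ zs⊆ , ≤-trans a<n n≤ , Rq)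
...   | inj₂ (q , q⊆ , t≤ , Bq) = inj₂ (x ∷ q , refl ∷ ⊆-trans q⊆ zs⊆ , s≤s t≤ , All-resp-⊆ q⊆ Bzs ∷ Bq)
ramsey-step n t IH (suc a) (x ∷ xs) (px ∷ pxs) a<n large
    | ys , zs , ys⊆ , zs⊆ , Rys , Bzs , eq | no zs-small
    with ramsey-step n t IH a ys (AllPairs-resp-⊆ ys⊆ pxs) (<⇒≤ a<n) ys-large
  where
  open ≤-Reasoning
  ys-large : a * n ^ suc t ≤ length ys
  ys-large = +-cancelˡ-≤ (n ^ suc t) _ _ (begin
    n ^ suc t + a * n ^ suc t      ≤⟨ large ⟩
    suc (length xs)                ≡⟨ trans (cong suc eq) (sym (+-suc (length ys) _)) ⟩
    -- The vertex `x` accounts for the `suc`, which the strict bound on `zs` absorbs.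
    length ys + suc (length zs)    ≤⟨ +-monoʳ-≤ (length ys) (≰⇒> zs-small) ⟩
    length ys + n ^ suc t          ≡⟨ +-comm (length ys) _ ⟩
    n ^ suc t + length ys          ∎)
... | inj₁ (q , q⊆ , a≤ , Rq) = inj₁ (x ∷ q , refl ∷ ⊆-trans q⊆ ys⊆ , s≤s a≤ , All-resp-⊆ q⊆ Rys ∷ Rq)
... | inj₂ (q , q⊆ , t≤ , Bq) = inj₂ (q , x ∷ʳ ⊆-trans q⊆ ys⊆ , t≤ , Bq)

-- The bound is polynomial in `n` for fixed `t`. It is used for red cliques of size `r` in a row and
-- for independent sets of size `suc m` in a column.
ramsey : ∀ {R B : A → A → Set} n t xs → AllPairs (λ x y → R x y ⊎ B x y) xs →
         n ^ suc t ≤ length xs → Clique R n xs ⊎ Clique B (suc t) xs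
ramsey zero    zero    xs       _   _     = inj₁ ([] , minimum xs , z≤n , [])
ramsey (suc n) zero    (x ∷ xs) _   _     = inj₂ (x ∷ [] , refl ∷ minimum xs , s≤s z≤n , [] ∷ [])
ramsey n       (suc t) xs       pxs large = ramsey-step n t (ramsey n t) n xs pxs ≤-refl large

lookup-AllPairs : ∀ {R : A → A → Set} → (∀ {x y} → R x y → R y x) → ∀ {xs} → AllPairs R xs →
                  ∀ i j → i ≢ j → R (lookup xs i) (lookup xs j)
lookup-AllPairs R-sym (p ∷ ps) zero    zero    i≢j = contradiction refl i≢j
lookup-AllPairs R-sym (p ∷ ps) zero    (suc j) i≢j = All.lookup p (∈-lookup j)
lookup-AllPairs R-sym (p ∷ ps) (suc i) zero    i≢j = R-sym (All.lookup p (∈-lookup i))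
lookup-AllPairs R-sym (p ∷ ps) (suc i) (suc j) i≢j = lookup-AllPairs R-sym ps i j (i≢j ∘ cong suc)

enumerate : ∀ {R : A → A → Set} → (∀ {x y} → R x y → R y x) → ∀ {k xs} → k ≤ length xs → AllPairs R xs →
            ∃ λ (f : Fin k → A) → ∀ i j → i ≢ j → R (f i) (f j)
enumerate R-sym {xs = xs} k≤ ps = (λ i → lookup xs (inject≤ i k≤)) , λ i j i≢j →
  lookup-AllPairs R-sym ps _ _ (i≢j ∘ Fₚ.inject≤-injective k≤ k≤ i j)

length-filter≡∑ : ∀ {P : A → Set} (P? : ∀ x → Dec (P x)) xs → length (filter P? xs) ≡ ∑ xs (λ x → 𝟙 (P? x))
length-filter≡∑ P? []       = refl
length-filter≡∑ P? (x ∷ xs) with P? x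
... | yes _ = cong suc (length-filter≡∑ P? xs)
... | no  _ = length-filter≡∑ P? xs

∑-⊆ : ∀ {xs ys : List A} f → xs ⊆ ys → ∑ xs f ≤ ∑ ys f
∑-⊆ f []         = z≤n
∑-⊆ f (y ∷ʳ s)   = ≤-trans (∑-⊆ f s) (m≤n+m _ (f y))
∑-⊆ f (refl ∷ s) = +-monoʳ-≤ (f _) (∑-⊆ f s)

∑-All : ∀ {xs : List A} {f c} → All (λ x → f x ≤ c) xs → ∑ xs f ≤ length xs * c
∑-All []       = z≤n
∑-All (p ∷ ps) = +-mono-≤ p (∑-All ps)

-- The largest class has at least the average size; `k₀` excludes `K = 0`, so that a class exists
-- even for empty `xs`.
pigeonhole : ∀ {K} (f : A → Fin K) (k₀ : Fin K) xs →
             ∃ λ k → length xs ≤ K * length (filter (λ x → f x F.≟ k) xs)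
pigeonhole {K = suc K} f k₀ xs with ∑-max zero (tabulate suc) (λ k → length (filter (λ x → f x F.≟ k) xs))
... | k , k-max = k , (begin
  length xs
    ≡⟨ trans (sym (*-identityʳ _)) (sym (∑-const xs 1)) ⟩
  ∑ xs (λ _ → 1)
    ≤⟨ ∑-mono xs (λ x → ≤-trans (≤-reflexive (sym (𝟙-yes (f x F.≟ f x) refl)))
         (∈⇒≤∑ (λ k → 𝟙 (f x F.≟ k)) (∈-allFin (f x)))) ⟩
  ∑ xs (λ x → ∑ (allFin (suc K)) (λ k → 𝟙 (f x F.≟ k)))
    ≡⟨ ∑-swap xs (allFin (suc K)) _ ⟩
  ∑ (allFin (suc K)) (λ k → ∑ xs (λ x → 𝟙 (f x F.≟ k)))
    ≡⟨ ∑-cong (allFin (suc K)) (λ k → sym (length-filter≡∑ (λ x → f x F.≟ k) xs)) ⟩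
  ∑ (allFin (suc K)) (λ k → length (filter (λ x → f x F.≟ k) xs))
    ≤⟨ k-max ⟩
  length (allFin (suc K)) * length (filter (λ x → f x F.≟ k) xs)
    ≡⟨ cong (_* length (filter (λ x → f x F.≟ k) xs)) (length-allFin (suc K)) ⟩
  suc K * length (filter (λ x → f x F.≟ k) xs) ∎)
  where open ≤-Reasoning

-- Each element with `f x > k` contributes at least `suc k` to the sum, so at most half of the
-- elements are of that kind.
markov : ∀ (xs : List A) f k → 2 * ∑ xs f ≤ suc k * length xs →
         length xs ≤ 2 * length (filter (λ x → f x ≤? k) xs)
markov {A = A} xs f k average = *-cancelˡ-≤ (suc k) (+-cancelˡ-≤ (suc k * length xs) _ _ (begin
  suc k * length xs + suc k * length xs    ≡⟨ double (suc k * length xs) ⟩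
  2 * (suc k * length xs)                  ≤⟨ *-monoʳ-≤ 2 (tail-bound xs) ⟩
  2 * (∑ xs f + suc k * small xs)          ≡⟨ regroup (∑ xs f) (suc k) (small xs) ⟩
  2 * ∑ xs f + suc k * (2 * small xs)      ≤⟨ +-monoˡ-≤ _ average ⟩
  suc k * length xs + suc k * (2 * small xs) ∎))
  where
  open ≤-Reasoning
  small : List A → ℕ
  small xs = length (filter (λ x → f x ≤? k) xs)
  double : ∀ a → a + a ≡ 2 * a
  double = solve-∀
  regroup : ∀ a b c → 2 * (a + b * c) ≡ 2 * a + b * (2 * c)
  regroup = solve-∀
  exchange : ∀ a b c d → (a + b) + (c + d) ≡ (a + c) + (b + d)
  exchange = solve-∀
  tail-bound : ∀ xs → suc k * length xs ≤ ∑ xs f + suc k * small xs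
  tail-bound []       = ≤-trans (≤-reflexive (*-zeroʳ (suc k))) z≤n
  tail-bound (x ∷ xs) = by-size (f x ≤? k)
    where
    by-size : Dec (f x ≤ k) → suc k * suc (length xs) ≤ (f x + ∑ xs f) + suc k * small (x ∷ xs)
    by-size (no f>k) = begin
      suc k * suc (length xs)                          ≡⟨ *-suc (suc k) (length xs) ⟩
      suc k + suc k * length xs                        ≤⟨ +-mono-≤ (≰⇒> f>k) (tail-bound xs) ⟩
      f x + (∑ xs f + suc k * small xs)                ≡⟨ sym (+-assoc (f x) _ _) ⟩
      (f x + ∑ xs f) + suc k * small xs
        ≡⟨ cong (λ ys → (f x + ∑ xs f) + suc k * length ys) (sym (filter-reject (λ x → f x ≤? k) f>k)) ⟩
      (f x + ∑ xs f) + suc k * small (x ∷ xs)          ∎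
    by-size (yes f≤k) = begin
      suc k * suc (length xs)                          ≡⟨ *-suc (suc k) (length xs) ⟩
      suc k + suc k * length xs                        ≤⟨ +-mono-≤ (m≤n+m (suc k) (f x)) (tail-bound xs) ⟩
      (f x + suc k) + (∑ xs f + suc k * small xs)      ≡⟨ exchange (f x) (suc k) (∑ xs f) _ ⟩
      (f x + ∑ xs f) + (suc k + suc k * small xs)
        ≡⟨ cong ((f x + ∑ xs f) +_) (sym (*-suc (suc k) (small xs))) ⟩
      (f x + ∑ xs f) + suc k * suc (small xs)
        ≡⟨ cong (λ ys → (f x + ∑ xs f) + suc k * length ys) (sym (filter-accept (λ x → f x ≤? k) f≤k)) ⟩
      (f x + ∑ xs f) + suc k * small (x ∷ xs)          ∎

-- Discarding a few elements to avoid all bad pairs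

module Trace {Bad : A → A → Set} (bad? : ∀ z u → Dec (Bad z u)) where

  count : List A → A → ℕ
  count Z u = ∑ Z (λ z → 𝟙 (bad? z u))

  private
    -- The index length Z stands for the absence of a bad element.
    firstBad : ∀ Z → A → Fin (suc (length Z))
    firstBad []      u = zero
    firstBad (z ∷ Z) u with bad? z u
    ... | yes _ = zero
    ... | no  _ = suc (firstBad Z u)

    delete : (Z : List A) → Fin (suc (length Z)) → List A
    delete []      i       = []
    delete (z ∷ Z) zero    = Z
    delete (z ∷ Z) (suc i) = z ∷ delete Z i

    delete-⊆ : ∀ Z i → delete Z i ⊆ Z
    delete-⊆ []      i       = []
    delete-⊆ (z ∷ Z) zero    = z ∷ʳ ⊆-refl
    delete-⊆ (z ∷ Z) (suc i) = refl ∷ delete-⊆ Z i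

    length-delete : ∀ Z i → length Z ≤ suc (length (delete Z i))
    length-delete []      i       = z≤n
    length-delete (z ∷ Z) zero    = ≤-refl
    length-delete (z ∷ Z) (suc i) = s≤s (length-delete Z i)

    count-delete : ∀ Z u {m} → count Z u ≤ suc m → count (delete Z (firstBad Z u)) u ≤ m
    count-delete []      u _ = z≤n
    count-delete (z ∷ Z) u few with bad? z u in eq
    ... | yes _ = ≤-pred few
    ... | no  _ rewrite eq = count-delete Z u few

    count≡0 : ∀ Z u → count Z u ≤ 0 → All (λ z → ¬ Bad z u) Z
    count≡0 []      u _ = []
    count≡0 (z ∷ Z) u none with bad? z u
    ... | no ¬bad = ¬bad ∷ count≡0 Z u none

  -- In each round the position of the first bad element takes at most `n` values, absence included.
  -- Keeping the most frequent value on `P` and deleting that element from `Z` lowers every positive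
  -- count by one. After `m` rounds no bad pair is left, while `Z` has lost at most `m` elements and
  -- `P` at most a factor `n ^ m`.
  refine : ∀ n m Z P → length Z < n → All (λ u → count Z u ≤ m) P →
           ∃ λ Z′ → ∃ λ P′ → Z′ ⊆ Z × P′ ⊆ P × length Z ≤ m + length Z′ × length P ≤ n ^ m * length P′ ×
             All (λ u → All (λ z → ¬ Bad z u) Z′) P′
  refine n zero    Z P Z<n few =
    Z , P , ⊆-refl , ⊆-refl , ≤-refl , ≤-reflexive (sym (+-identityʳ _)) , All.map (count≡0 Z _) few
  refine n (suc m) Z P Z<n few with pigeonhole (firstBad Z) zero P
  ... | i , popular with refine n m (delete Z i) P₁ (≤-<-trans (length-mono-≤ (delete-⊆ Z i)) Z<n) few₁
    where
    P₁ : List A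
    P₁ = filter (λ u → firstBad Z u F.≟ i) P
    few₁ : All (λ u → count (delete Z i) u ≤ m) P₁
    few₁ = All.zipWith (λ { (refl , c) → count-delete Z _ c })
      (all-filter (λ u → firstBad Z u F.≟ i) P , All-resp-⊆ (filter-⊆ (λ u → firstBad Z u F.≟ i) P) few)
  ... | Z′ , P′ , Z′⊆ , P′⊆ , Z-loss , P-loss , good =
    Z′ , P′ , ⊆-trans Z′⊆ (delete-⊆ Z i) , ⊆-trans P′⊆ (filter-⊆ _ P) ,
    ≤-trans (length-delete Z i) (s≤s Z-loss) ,
    ≤-trans popular (≤-trans (*-mono-≤ Z<n P-loss) (≤-reflexive (sym (*-assoc n (n ^ m) _)))) ,
    good

-- The upper bound

-- An independent set Z of the sparsest graph is enlarged by returning each time to the whole set L of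
-- low-degree vertices: most of them have at most m neighbours in Z, and pigeonholing over these
-- neighbours costs only a factor n ^ m.  What is left contains more than m further vertices
-- that can be added in exchange for the neighbours.
module ErdősSzemerédi (R r′ n m : ℕ) (Red : Fin (2 + r′) → Fin R → Fin R → Set)
  (red? : ∀ i x u → Dec (Red i x u))
  (disjoint : ∀ {i j : Fin (2 + r′)} {x u : Fin R} → i ≢ j → x ≢ u → Red i x u → ¬ Red j x u)
  (1≤n : 1 ≤ n)
  (r≤R : 2 + r′ ≤ R)
  (R-large : 4 * (n ^ m * n ^ suc m) ≤ R)
  (m-large : 16 * n ≤ (2 + r′) * suc m) where

  private
    r = 2 + r′

  Blue : Fin r → Fin R → Fin R → Set
  Blue i x u = x ≢ u × ¬ Red i x u

  BlueSet : Set
  BlueSet = ∃ λ i → ∃ λ Q → n ≤ length Q × AllPairs (Blue i) Q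

  -- A vertex counts as bad for itself, so sets without bad pairs between them are disjoint and can
  -- be joined without repetition.
  Bad : Fin r → Fin R → Fin R → Set
  Bad i x u = x ≡ u ⊎ Red i x u

  bad? : ∀ i x u → Dec (Bad i x u)
  bad? i x u = (x F.≟ u) ⊎-dec red? i x u

  ¬bad⇒blue : ∀ {i x u} → ¬ Bad i x u → Blue i x u
  ¬bad⇒blue ¬bad = ¬bad ∘ inj₁ , ¬bad ∘ inj₂

  degree : Fin r → Fin R → ℕ
  degree i x = ∑ (allFin R) (λ u → 𝟙 (bad? i x u))

  -- Off the diagonal the red graphs are disjoint; on it the equality in `Bad` counts once for each
  -- of them.
  pair-bound : ∀ x u (d : Dec (x ≡ u)) → ∑ (allFin r) (λ i → 𝟙 (bad? i x u)) ≤ 1 + r * 𝟙 d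
  pair-bound x u (yes _) = begin
    ∑ (allFin r) (λ i → 𝟙 (bad? i x u))    ≤⟨ ∑-≤-length (allFin r) (λ i → 𝟙≤1 (bad? i x u)) ⟩
    length (allFin r)                      ≡⟨ length-allFin r ⟩
    r                                      ≡⟨ sym (*-identityʳ r) ⟩
    r * 1                                  ≤⟨ n≤1+n _ ⟩
    1 + r * 1                              ∎
    where open ≤-Reasoning
  pair-bound x u (no x≢u) = ≤-trans
    (∑-exclusive≤1 (λ i → bad? i x u) exclusive (allFin⁺ r)) (m≤m+n 1 (r * 0))
    where
    exclusive : ∀ {i j} → i ≢ j → Bad i x u → ¬ Bad j x u
    exclusive i≢j (inj₁ x≡u) _          = x≢u x≡u
    exclusive i≢j (inj₂ _)   (inj₁ x≡u) = x≢u x≡u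
    exclusive i≢j (inj₂ p)   (inj₂ q)   = disjoint i≢j x≢u p q

  total : ∑ (allFin r) (λ i → ∑ (allFin R) (degree i)) ≤ R * (R + R)
  total = begin
    ∑ (allFin r) (λ i → ∑ (allFin R) (degree i))
      ≡⟨ ∑-swap (allFin r) (allFin R) degree ⟩
    ∑ (allFin R) (λ x → ∑ (allFin r) (λ i → degree i x))
      ≡⟨ ∑-cong (allFin R) (λ x → ∑-swap (allFin r) (allFin R) (λ i u → 𝟙 (bad? i x u))) ⟩
    ∑ (allFin R) (λ x → ∑ (allFin R) (λ u → ∑ (allFin r) (λ i → 𝟙 (bad? i x u))))
      ≤⟨ ∑-mono (allFin R) (λ x → ∑-mono (allFin R) (λ u → pair-bound x u (x F.≟ u))) ⟩
    ∑ (allFin R) (λ x → ∑ (allFin R) (λ u → 1 + r * 𝟙 (x F.≟ u)))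
      ≤⟨ ∑-mono (allFin R) row ⟩
    ∑ (allFin R) (λ _ → R + R)
      ≡⟨ trans (∑-const (allFin R) (R + R)) (cong (_* (R + R)) (length-allFin R)) ⟩
    R * (R + R) ∎
    where
    open ≤-Reasoning
    row : ∀ x → ∑ (allFin R) (λ u → 1 + r * 𝟙 (x F.≟ u)) ≤ R + R
    row x = begin
      ∑ (allFin R) (λ u → 1 + r * 𝟙 (x F.≟ u))
        ≡⟨ ∑-+ (allFin R) (λ _ → 1) _ ⟩
      ∑ (allFin R) (λ _ → 1) + ∑ (allFin R) (λ u → r * 𝟙 (x F.≟ u))
        ≡⟨ cong₂ _+_ (trans (∑-const (allFin R) 1) (trans (*-identityʳ _) (length-allFin R)))
                     (∑-* (allFin R) r _) ⟩
      R + r * ∑ (allFin R) (λ u → 𝟙 (x F.≟ u))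
        ≤⟨ +-monoʳ-≤ R (*-mono-≤ r≤R (∑-𝟙≤1 x (allFin⁺ R))) ⟩
      R + R * 1
        ≡⟨ cong (R +_) (*-identityʳ R) ⟩
      R + R ∎

  module _ (i : Fin r) (∑-degree : r * ∑ (allFin R) (degree i) ≤ R * (R + R)) where

    -- The average degree in graph `i` is at most `2 * R / r` by `∑-degree`; the threshold is twice
    -- that, so at least half of the vertices pass.
    Low : Fin R → Set
    Low x = r * degree i x ≤ 4 * R

    low? : ∀ x → Dec (Low x)
    low? x = r * degree i x ≤? 4 * R

    L : List (Fin R)
    L = filter low? (allFin R)

    L-large : R ≤ 2 * length L
    L-large = ≤-trans (≤-reflexive (sym (length-allFin R)))
                      (markov (allFin R) (λ x → r * degree i x) (4 * R) (begin
      2 * ∑ (allFin R) (λ x → r * degree i x)    ≡⟨ cong (2 *_) (∑-* (allFin R) r (degree i)) ⟩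
      2 * (r * ∑ (allFin R) (degree i))          ≤⟨ *-monoʳ-≤ 2 ∑-degree ⟩
      2 * (R * (R + R))                          ≡⟨ identity R ⟩
      4 * R * R                                  ≤⟨ *-monoˡ-≤ R (n≤1+n (4 * R)) ⟩
      suc (4 * R) * R                            ≡⟨ cong (suc (4 * R) *_) (sym (length-allFin R)) ⟩
      suc (4 * R) * length (allFin R)            ∎))
      where
      open ≤-Reasoning
      identity : ∀ R → 2 * (R * (R + R)) ≡ 4 * R * R
      identity = solve-∀

    open Trace (bad? i)

    few? : ∀ Z u → Dec (count Z u ≤ m)
    few? Z u = count Z u ≤? m

    -- There are at most `n * 4 * R / r` bad pairs between `Z` and `L`, hence on average at most
    -- `8 * n / r` per vertex of `L`, since `R ≤ 2 * length L`. By `m-large`, with its factor 16,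
    -- this is at most half of `suc m`, as `markov` requires.
    few-large : ∀ Z → length Z ≤ n → All Low Z → length L ≤ 2 * length (filter (few? Z) L)
    few-large Z Z≤n low = markov L (count Z) m (*-cancelˡ-≤ r (begin
      r * (2 * ∑ L (count Z))
        ≡⟨ cong (λ s → r * (2 * s)) (∑-swap L Z (λ u z → 𝟙 (bad? i z u))) ⟩
      r * (2 * ∑ Z (λ z → ∑ L (λ u → 𝟙 (bad? i z u))))
        ≤⟨ *-monoʳ-≤ r (*-monoʳ-≤ 2 (∑-mono Z (λ z → ∑-⊆ (λ u → 𝟙 (bad? i z u)) (filter-⊆ low? (allFin R))))) ⟩
      r * (2 * ∑ Z (degree i))
        ≡⟨ swap r 2 (∑ Z (degree i)) ⟩
      2 * (r * ∑ Z (degree i))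
        ≡⟨ cong (2 *_) (sym (∑-* Z r (degree i))) ⟩
      2 * ∑ Z (λ z → r * degree i z)
        ≤⟨ *-monoʳ-≤ 2 (∑-All low) ⟩
      2 * (length Z * (4 * R))
        ≤⟨ *-monoʳ-≤ 2 (*-mono-≤ Z≤n (*-monoʳ-≤ 4 L-large)) ⟩
      2 * (n * (4 * (2 * length L)))
        ≡⟨ identity n (length L) ⟩
      16 * n * length L
        ≤⟨ *-monoˡ-≤ (length L) m-large ⟩
      r * suc m * length L
        ≡⟨ *-assoc r (suc m) (length L) ⟩
      r * (suc m * length L) ∎))
      where
      open ≤-Reasoning
      swap : ∀ a b c → a * (b * c) ≡ b * (a * c)
      swap = solve-∀
      identity : ∀ n l → 2 * (n * (4 * (2 * l))) ≡ 16 * n * l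
      identity = solve-∀

    IndependentSet : ℕ → Set
    IndependentSet k = ∃ λ Z → k ≤ length Z × All Low Z × AllPairs (λ x u → ¬ Bad i x u) Z

    -- It exists because there are `2 + r′` graphs; by `disjoint`, a red clique of graph `i` is blue
    -- in graph `j`.
    another-colour : ∃ λ j → i ≢ j
    another-colour with i F.≟ zero
    ... | yes refl = suc zero , λ ()
    ... | no  i≢0  = zero , i≢0

    from-independent : IndependentSet n → BlueSet
    from-independent (Z , n≤ , _ , Z-ind) = i , Z , n≤ , AllPairs.map ¬bad⇒blue Z-ind

    classify : ∀ {P} → Unique P → AllPairs (λ x u → (x ≢ u × Red i x u) ⊎ ¬ Bad i x u) P
    classify = AllPairs.map λ {x} {u} x≢u → by-colour x≢u (red? i x u)
      where
      by-colour : ∀ {x u} → x ≢ u → Dec (Red i x u) → (x ≢ u × Red i x u) ⊎ ¬ Bad i x u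
      by-colour x≢u (yes p) = inj₁ (x≢u , p)
      by-colour x≢u (no ¬p) = inj₂ λ { (inj₁ x≡u) → x≢u x≡u ; (inj₂ p) → ¬p p }

    enlarge : ∀ k → k < n → IndependentSet k → BlueSet ⊎ IndependentSet (suc k)
    enlarge k k<n (Z , k≤Z , Z-low , Z-ind) with n ≤? length Z
    -- A set of `n` vertices ends the search; below that size `refine` has at most `n` indices to
    -- choose from.
    ... | yes n≤Z = inj₁ (from-independent (Z , n≤Z , Z-low , Z-ind))
    ... | no  n≰Z with refine n m Z P (≰⇒> n≰Z) (all-filter (few? Z) L)
      where
      P = filter (few? Z) L
    ...   | Z′ , P′ , Z′⊆Z , P′⊆P , Z-loss , P-loss , good =
        by-ramsey (ramsey n m P′ (classify (AllPairs-resp-⊆ P′⊆ (allFin⁺ R))) P′-large)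
      where
      open ≤-Reasoning
      P = filter (few? Z) L
      P′⊆L : P′ ⊆ L
      P′⊆L = ⊆-trans P′⊆P (filter-⊆ (few? Z) L)
      P′⊆ : P′ ⊆ allFin R
      P′⊆ = ⊆-trans P′⊆L (filter-⊆ low? (allFin R))
      instance
        _ = >-nonZero 1≤n
        _ = m^n≢0 n m
        _ = m*n≢0 4 (n ^ m)
      -- The factor 4 pays for two halvings, in `L-large` and in `few-large`.
      P′-large : n ^ suc m ≤ length P′
      P′-large = *-cancelˡ-≤ (4 * n ^ m) (begin
        4 * n ^ m * n ^ suc m            ≡⟨ *-assoc 4 (n ^ m) (n ^ suc m) ⟩
        4 * (n ^ m * n ^ suc m)          ≤⟨ R-large ⟩
        R                                ≤⟨ L-large ⟩
        2 * length L                     ≤⟨ *-monoʳ-≤ 2 (few-large Z (<⇒≤ (≰⇒> n≰Z)) Z-low) ⟩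
        2 * (2 * length P)               ≤⟨ *-monoʳ-≤ 2 (*-monoʳ-≤ 2 P-loss) ⟩
        2 * (2 * (n ^ m * length P′))    ≡⟨ identity (n ^ m) (length P′) ⟩
        4 * n ^ m * length P′            ∎)
        where
        identity : ∀ a b → 2 * (2 * (a * b)) ≡ 4 * a * b
        identity = solve-∀
      by-ramsey : Clique (λ x u → x ≢ u × Red i x u) n P′ ⊎ Clique (λ x u → ¬ Bad i x u) (suc m) P′ →
                  BlueSet ⊎ IndependentSet (suc k)
      by-ramsey (inj₁ (Q , _ , n≤ , Q-red)) with another-colour
      ... | j , i≢j = inj₁ (j , Q , n≤ , AllPairs.map (λ (x≢u , p) → x≢u , disjoint i≢j x≢u p) Q-red)
      by-ramsey (inj₂ (Q , Q⊆ , m<Q , Q-ind)) = inj₂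
        -- At most `m` vertices of `Z` are lost and at least `suc m` are gained from `Q`.
        ( Z′ ++ Q
        , (begin
            suc k                    ≤⟨ s≤s (≤-trans k≤Z Z-loss) ⟩
            suc (m + length Z′)      ≡⟨ cong suc (+-comm m _) ⟩
            suc (length Z′ + m)      ≡⟨ sym (+-suc (length Z′) m) ⟩
            length Z′ + suc m        ≤⟨ +-monoʳ-≤ (length Z′) m<Q ⟩
            length Z′ + length Q     ≡⟨ sym (length-++ Z′) ⟩
            length (Z′ ++ Q)         ∎)
        , Allₚ.++⁺ (All-resp-⊆ Z′⊆Z Z-low) (All-resp-⊆ (⊆-trans Q⊆ P′⊆L) (all-filter low? (allFin R)))
        , AllPairsₚ.++⁺ (AllPairs-resp-⊆ Z′⊆Z Z-ind) Q-ind (All-swap (All-resp-⊆ Q⊆ good)) )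

    grow : ∀ k → k ≤ n → BlueSet ⊎ IndependentSet k
    grow zero    _   = inj₂ ([] , z≤n , [] , [])
    grow (suc k) k<n with grow k (<⇒≤ k<n)
    ... | inj₁ set = inj₁ set
    ... | inj₂ Z   = enlarge k k<n Z

    blue-set-of : BlueSet
    blue-set-of with grow n ≤-refl
    ... | inj₁ set = set
    ... | inj₂ Z   = from-independent Z

  sparsest : ∃ λ i → length (allFin r) * ∑ (allFin R) (degree i) ≤ ∑ (allFin r) (λ i → ∑ (allFin R) (degree i))
  sparsest = ∑-min zero (tabulate suc) (λ i → ∑ (allFin R) (degree i))

  blue-set : BlueSet
  blue-set = blue-set-of (proj₁ sparsest) (≤-trans
    (≤-reflexive (cong (_* ∑ (allFin R) (degree (proj₁ sparsest))) (sym (length-allFin r))))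
    (≤-trans (proj₂ sparsest) total))

-- From red cliques in the rows to a blue clique

_≟ᶜ_ : (a b : Colour) → Dec (a ≡ b)
red  ≟ᶜ red  = yes refl
blue ≟ᶜ blue = yes refl
red  ≟ᶜ blue = no λ ()
blue ≟ᶜ red  = no λ ()

≢red⇒≡blue : ∀ {a} → a ≢ red → a ≡ blue
≢red⇒≡blue {red}  a≢red = contradiction refl a≢red
≢red⇒≡blue {blue} _     = refl

redRectangle? : ∀ {N} (c : Colouring N) → Dec (RedRectangle c)
redRectangle? c = Fₚ.any? λ x → Fₚ.any? λ x′ → Fₚ.any? λ y → Fₚ.any? λ y′ →
  ¬? (x F.≟ x′) ×-dec ¬? (y F.≟ y′) ×-dec
  (col c (x , y) (x , y′) ≟ᶜ red) ×-dec (col c (x , y′) (x′ , y′) ≟ᶜ red) ×-dec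
  (col c (x′ , y′) (x′ , y) ≟ᶜ red) ×-dec (col c (x′ , y) (x , y) ≟ᶜ red)

distribute : ∀ {N} {P : Fin N → Set} → (∀ x → A ⊎ P x) → A ⊎ (∀ x → P x)
distribute {N = zero}  f = inj₂ λ ()
distribute {N = suc N} f with f zero | distribute (f ∘ suc)
... | inj₁ a | _      = inj₁ a
... | inj₂ p | inj₁ a = inj₁ a
... | inj₂ p | inj₂ q = inj₂ λ { zero → p ; (suc x) → q x }

-- Row cliques are sought only in the first `M = n ^ r` columns, so a row picks one of `M ^ r`
-- tuples of `r` columns; `N-large` leaves at least `R₀` rows with the same tuple.
module UpperBound (n r′ m N : ℕ) (c : Colouring N)
  (1≤n : 1 ≤ n)
  (M≤N : n ^ (2 + r′) ≤ N)
  (N-large : (n ^ (2 + r′)) ^ (2 + r′) * (4 * (n ^ m * n ^ suc m)) ≤ N)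
  (r-small : 2 + r′ ≤ 4 * (n ^ m * n ^ suc m))
  (m-large : 16 * n ≤ (2 + r′) * suc m)
  (no-rectangle : ¬ RedRectangle c) where

  private
    r = 2 + r′
    M = n ^ r
    R₀ = 4 * (n ^ m * n ^ suc m)
    instance
      _ = >-nonZero 1≤n
      _ = m^n≢0 n r
      _ = m^n≢0 M r

  ι : Fin M → Fin N
  ι y = inject≤ y M≤N

  ι-injective : ∀ {y y′} → ι y ≡ ι y′ → y ≡ y′
  ι-injective = Fₚ.inject≤-injective M≤N M≤N _ _

  Joined : Colour → Fin N → Fin M → Fin M → Set
  Joined a x y y′ = y ≢ y′ × col c (x , ι y) (x , ι y′) ≡ a

  Joined-sym : ∀ {a x y y′} → Joined a x y y′ → Joined a x y′ y
  Joined-sym (y≢y′ , p) = y≢y′ ∘ sym , trans (symm c _ _) p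

  RedRow : Fin N → Set
  RedRow x = ∃ λ (J : Fin r → Fin M) → ∀ i j → i ≢ j → Joined red x (J i) (J j)

  row-clique : ∀ x → BlueClique c n ⊎ RedRow x
  row-clique x with ramsey n (suc r′) (allFin M) joined (≤-reflexive (sym (length-allFin M)))
    where
    joined : AllPairs (λ y y′ → Joined blue x y y′ ⊎ Joined red x y y′) (allFin M)
    joined = AllPairs.map (λ {y} {y′} y≢y′ → by-colour y≢y′ (col c (x , ι y) (x , ι y′) ≟ᶜ red)) (allFin⁺ M)
      where
      by-colour : ∀ {y y′} → y ≢ y′ → Dec (col c (x , ι y) (x , ι y′) ≡ red) →
                  Joined blue x y y′ ⊎ Joined red x y y′
      by-colour y≢y′ (yes p) = inj₂ (y≢y′ , p)
      by-colour y≢y′ (no ¬p) = inj₁ (y≢y′ , ≢red⇒≡blue ¬p)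
  ... | inj₂ (Q , _ , r≤Q , Q-red) = inj₂ (enumerate Joined-sym r≤Q Q-red)
  ... | inj₁ (Q , _ , n≤Q , Q-blue) with enumerate Joined-sym n≤Q Q-blue
  ...   | f , f-blue = inj₁ ((λ i → x , ι (f i)) , f-inj , λ i j i≢j →
            inj₁ (refl , proj₁ (f-blue i j i≢j) ∘ ι-injective) , proj₂ (f-blue i j i≢j))
    where
    f-inj : ∀ i j → (x , ι (f i)) ≡ (x , ι (f j)) → i ≡ j
    f-inj i j eq with i F.≟ j
    ... | yes i≡j = i≡j
    ... | no  i≢j = contradiction (ι-injective (cong proj₂ eq)) (proj₁ (f-blue i j i≢j))

  module ManyRows (R : ℕ) (R₀≤R : R₀ ≤ R)
    (row : Fin R → Fin N) (row-distinct : ∀ {x u : Fin R} → x ≢ u → row x ≢ row u)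
    (column : Fin r → Fin M) (column-red : ∀ x i j → i ≢ j → Joined red (row x) (column i) (column j)) where

    Red : Fin r → Fin R → Fin R → Set
    Red i x u = col c (row x , ι (column i)) (row u , ι (column i)) ≡ red

    -- Both rows are red between the two columns, so two red column edges would close a red
    -- rectangle.
    disjoint : ∀ {i j x u} → i ≢ j → x ≢ u → Red i x u → ¬ Red j x u
    disjoint {i} {j} {x} {u} i≢j x≢u p q = no-rectangle
      ( row x , row u , ι (column i) , ι (column j)
      , row-distinct x≢u , proj₁ (column-red x i j i≢j) ∘ ι-injective
      , proj₂ (column-red x i j i≢j) , q , proj₂ (column-red u j i (i≢j ∘ sym)) , trans (symm c _ _) p )

    open ErdősSzemerédi R r′ n m Red (λ i x u → _ ≟ᶜ red) disjoint 1≤n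
      (≤-trans r-small R₀≤R) R₀≤R m-large

    from-blue-set : BlueSet → BlueClique c n
    from-blue-set (i , Q , n≤Q , Q-blue)
        with enumerate (λ (x≢u , ¬p) → x≢u ∘ sym , ¬p ∘ trans (symm c _ _)) n≤Q Q-blue
    ... | f , f-blue = (λ a → row (f a) , ι (column i)) , f-inj , λ a b a≢b →
              inj₂ (row-distinct (proj₁ (f-blue a b a≢b)) , refl) , ≢red⇒≡blue (proj₂ (f-blue a b a≢b))
      where
      f-inj : ∀ a b → (row (f a) , ι (column i)) ≡ (row (f b) , ι (column i)) → a ≡ b
      f-inj a b eq with a F.≟ b
      ... | yes a≡b = a≡b
      ... | no  a≢b = contradiction (cong proj₁ eq) (row-distinct (proj₁ (f-blue a b a≢b)))

    column-clique : BlueClique c n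
    column-clique = from-blue-set blue-set

  module _ (red-rows : ∀ x → RedRow x) where

    columns : Fin N → Fin (M ^ r)
    columns x = funToFin (proj₁ (red-rows x))

    popular : ∃ λ k → length (allFin N) ≤ M ^ r * length (filter (λ x → columns x F.≟ k) (allFin N))
    popular = pigeonhole columns (F.fromℕ< (m^n>0 M r)) (allFin N)

    k : Fin (M ^ r)
    k = proj₁ popular

    rows : List (Fin N)
    rows = filter (λ x → columns x F.≟ k) (allFin N)

    R : ℕ
    R = length rows

    R₀≤R : R₀ ≤ R
    R₀≤R = *-cancelˡ-≤ (M ^ r) (≤-trans N-large
             (≤-trans (≤-reflexive (sym (length-allFin N))) (proj₂ popular)))

    row : Fin R → Fin N
    row = lookup rows

    row-distinct : ∀ {x u} → x ≢ u → row x ≢ row u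
    row-distinct {x} {u} =
      lookup-AllPairs (λ p → p ∘ sym) (AllPairs-resp-⊆ (filter-⊆ _ (allFin N)) (allFin⁺ N)) x u

    column : Fin r → Fin M
    column = finToFun k

    column-red : ∀ x i j → i ≢ j → Joined red (row x) (column i) (column j)
    column-red x i j i≢j = subst₂ (Joined red (row x)) (at i) (at j) (proj₂ (red-rows (row x)) i j i≢j)
      where
      same : columns (row x) ≡ k
      same = All.lookup (all-filter (λ x → columns x F.≟ k) (allFin N)) (∈-lookup x)
      at : ∀ i → proj₁ (red-rows (row x)) i ≡ column i
      at i = trans (sym (Fₚ.finToFun-funToFin (proj₁ (red-rows (row x))) i)) (cong (λ k → finToFun k i) same)

    rows-clique : BlueClique c n
    rows-clique = ManyRows.column-clique R R₀≤R row row-distinct column column-red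

  blue-clique : BlueClique c n
  blue-clique with distribute row-clique
  ... | inj₁ clique   = clique
  ... | inj₂ red-rows = rows-clique red-rows

-- Parameters for the upper bound

least : ∀ {P : ℕ → Set} → (∀ n → Dec (P n)) → ∀ k → P k → ∃ λ m → P m × (∀ j → P j → m ≤ j)
least {P} P? = <-rec _ step
  where
  step : ∀ k → (∀ {j} → j < k → P j → ∃ λ m → P m × (∀ i → P i → m ≤ i)) →
         P k → ∃ λ m → P m × (∀ i → P i → m ≤ i)
  step k rec Pk with anyUpTo? P? k
  ... | yes (j , j<k , Pj) = rec j<k Pj
  ... | no  none           = k , Pk , λ i Pi → ≮⇒≥ λ i<k → none (i , i<k , Pi)

-- `r` is the square root of `suc m` up to a constant factor; it starts at 2 and steps up whenever
-- `suc m` overtakes `r * r`.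
square-bracket : ∀ m → ∃ λ r′ → let r = 2 + r′ in suc m ≤ r * r × r * r ≤ 4 * suc m
square-bracket zero = 0 , s≤s z≤n , ≤-refl
square-bracket (suc m) with square-bracket m
... | r′ , m≤ , ≤4m with suc (suc m) ≤? (2 + r′) * (2 + r′)
... | yes m+1≤ = r′ , m+1≤ , ≤-trans ≤4m (*-monoʳ-≤ 4 (n≤1+n (suc m)))
... | no  m+1≰ = suc r′ , ≤-trans (s≤s m≤) (*-mono-< (n<1+n r) (n<1+n r)) , (begin
  -- The added polynomial in `r′` is the difference between `4 * suc (r * r)` and `suc r * suc r`.
  suc r * suc r                  ≤⟨ m≤m+n _ (3 * (r′ * r′) + 10 * r′ + 11) ⟩
  suc r * suc r + (3 * (r′ * r′) + 10 * r′ + 11)  ≡⟨ identity r′ ⟩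
  4 * suc (r * r)                ≤⟨ *-monoʳ-≤ 4 (≰⇒> m+1≰) ⟩
  4 * suc (suc m)                ∎)
  where
  open ≤-Reasoning
  r = 2 + r′
  identity : ∀ r′ → (3 + r′) * (3 + r′) + (3 * (r′ * r′) + 10 * r′ + 11) ≡ 4 * (1 + (2 + r′) * (2 + r′))
  identity = solve-∀

-- `m₀` stands for `n ^ (2/3)` and `r` for its square root, so that `r * r`, the exponent of the
-- number of column tuples, and `m` are both of order `m₀`. The factor in `suc m ≡ 16 * m₀` turns
-- `n ≤ r * m₀` into `m-large`.
module Parameters (n m₀′ r′ m : ℕ) (2≤n : 2 ≤ n)
  (n²≤m₀³ : n ^ 2 ≤ suc m₀′ ^ 3)
  (m₀≤r² : suc m₀′ ≤ (2 + r′) * (2 + r′))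
  (r²≤4m₀ : (2 + r′) * (2 + r′) ≤ 4 * suc m₀′)
  (m≡ : suc m ≡ 16 * suc m₀′) where

  open ≤-Reasoning

  r m₀ R₀ N : ℕ
  r  = 2 + r′
  m₀ = suc m₀′
  R₀ = 4 * (n ^ m * n ^ suc m)
  N  = (n ^ r) ^ r * R₀

  1≤n : 1 ≤ n
  1≤n = ≤-trans (s≤s z≤n) 2≤n

  private
    instance
      _ = >-nonZero 1≤n
      _ = m^n≢0 n r
      _ = m^n≢0 (n ^ r) r
      _ = m^n≢0 n m
      _ = m^n≢0 n (suc m)
      _ = m*n≢0 (n ^ m) (n ^ suc m)
      _ = m*n≢0 4 (n ^ m * n ^ suc m)

  n≤r*m₀ : n ≤ r * m₀
  n≤r*m₀ = ≮⇒≥ λ rm₀<n → <-irrefl refl (begin-strict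
    n ^ 2                  ≤⟨ n²≤m₀³ ⟩
    m₀ ^ 3                 ≡⟨ cube m₀ ⟩
    m₀ * (m₀ * m₀)         ≤⟨ *-monoˡ-≤ (m₀ * m₀) m₀≤r² ⟩
    r * r * (m₀ * m₀)      ≡⟨ interchange r m₀ ⟩
    r * m₀ * (r * m₀)      <⟨ *-mono-< rm₀<n rm₀<n ⟩
    n * n                  ≡⟨ cong (n *_) (sym (*-identityʳ n)) ⟩
    n ^ 2                  ∎)
    where
    cube : ∀ a → a * (a * (a * 1)) ≡ a * (a * a)
    cube = solve-∀
    interchange : ∀ a b → a * a * (b * b) ≡ a * b * (a * b)
    interchange = solve-∀

  m-large : 16 * n ≤ r * suc m
  m-large = begin
    16 * n             ≤⟨ *-monoʳ-≤ 16 n≤r*m₀ ⟩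
    16 * (r * m₀)      ≡⟨ swap 16 r m₀ ⟩
    r * (16 * m₀)      ≡⟨ cong (r *_) (sym m≡) ⟩
    r * suc m          ∎
    where
    swap : ∀ a b c → a * (b * c) ≡ b * (a * c)
    swap = solve-∀

  r-small : r ≤ R₀
  r-small = begin
    r                            ≤⟨ m≤m*n r r ⟩
    r * r                        ≤⟨ r²≤4m₀ ⟩
    4 * m₀                       ≤⟨ *-monoˡ-≤ m₀ (m≤m+n 4 12) ⟩
    16 * m₀                      ≡⟨ sym m≡ ⟩
    suc m                        ≤⟨ <⇒≤ (n<2^n (suc m)) ⟩
    2 ^ suc m                    ≤⟨ ^-monoˡ-≤ (suc m) 2≤n ⟩
    n ^ suc m                    ≤⟨ m≤n*m (n ^ suc m) (n ^ m) ⟩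
    n ^ m * n ^ suc m            ≤⟨ m≤n*m (n ^ m * n ^ suc m) 4 ⟩
    4 * (n ^ m * n ^ suc m)      ∎

  M≤N : n ^ r ≤ N
  M≤N = begin
    n ^ r                ≡⟨ sym (^-identityʳ (n ^ r)) ⟩
    (n ^ r) ^ 1          ≤⟨ ^-monoʳ-≤ (n ^ r) {1} {r} (s≤s z≤n) ⟩
    (n ^ r) ^ r          ≤⟨ m≤m*n ((n ^ r) ^ r) R₀ ⟩
    N                    ∎

  arrows : GrArrows N n
  arrows c with redRectangle? c
  ... | yes rectangle = inj₁ rectangle
  ... | no  none      = inj₂ (UpperBound.blue-clique n r′ m N c 1≤n M≤N ≤-refl r-small m-large none)

  -- `38 = 4 + 2 + 32`, from `r * r`, from the factor `4 ≤ n ^ 2` in `R₀`, and from twice `suc m`.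
  exponent : r * r + (2 + (m + suc m)) ≤ 38 * m₀
  exponent = begin
    r * r + (2 + (m + suc m))
      ≤⟨ +-mono-≤ r²≤4m₀ (+-mono-≤ (*-monoʳ-≤ 2 {1} {m₀} (s≤s z≤n)) (+-monoˡ-≤ (suc m) (n≤1+n m))) ⟩
    4 * m₀ + (2 * m₀ + (suc m + suc m))
      ≡⟨ cong (λ k → 4 * m₀ + (2 * m₀ + (k + k))) m≡ ⟩
    4 * m₀ + (2 * m₀ + (16 * m₀ + 16 * m₀))
      ≡⟨ identity m₀ ⟩
    38 * m₀ ∎
    where
    identity : ∀ a → 4 * a + (2 * a + (16 * a + 16 * a)) ≡ 38 * a
    identity = solve-∀

  N≤ : N ≤ n ^ (38 * m₀)
  N≤ = begin
    (n ^ r) ^ r * (4 * (n ^ m * n ^ suc m))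
      ≤⟨ *-mono-≤ (≤-reflexive (^-*-assoc n r r))
                  (*-mono-≤ (^-monoˡ-≤ 2 2≤n) (≤-reflexive (sym (^-distribˡ-+-* n m (suc m))))) ⟩
    n ^ (r * r) * (n ^ 2 * n ^ (m + suc m))
      ≡⟨ cong (n ^ (r * r) *_) (sym (^-distribˡ-+-* n 2 (m + suc m))) ⟩
    n ^ (r * r) * n ^ (2 + (m + suc m))
      ≡⟨ sym (^-distribˡ-+-* n (r * r) (2 + (m + suc m))) ⟩
    n ^ (r * r + (2 + (m + suc m)))
      ≤⟨ ^-monoʳ-≤ n exponent ⟩
    n ^ (38 * m₀) ∎

  N-small : ∀ k → m₀ ≤ k → N ^ 1 ≤ 2 ^ (38 * (k * ⌈log₂ n ⌉))
  N-small k m₀≤k = begin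
    N ^ 1                              ≡⟨ ^-identityʳ N ⟩
    N                                  ≤⟨ N≤ ⟩
    n ^ (38 * m₀)                      ≤⟨ ^-monoˡ-≤ (38 * m₀) (n≤2^⌈log₂n⌉ n) ⟩
    (2 ^ ⌈log₂ n ⌉) ^ (38 * m₀)        ≡⟨ ^-*-assoc 2 ⌈log₂ n ⌉ (38 * m₀) ⟩
    2 ^ (⌈log₂ n ⌉ * (38 * m₀))        ≤⟨ ^-monoʳ-≤ 2 (*-monoʳ-≤ ⌈log₂ n ⌉ (*-monoʳ-≤ 38 m₀≤k)) ⟩
    2 ^ (⌈log₂ n ⌉ * (38 * k))         ≡⟨ cong (2 ^_) (rotate ⌈log₂ n ⌉ 38 k) ⟩
    2 ^ (38 * (k * ⌈log₂ n ⌉))         ∎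
    where
    rotate : ∀ a b c → a * (b * c) ≡ b * (c * a)
    rotate = solve-∀

upper-bound : ∀ n → 2 ≤ n →
  Σ ℕ λ N → GrArrows N n × (∀ m → n ^ 2 ≤ m ^ 3 → N ^ 1 ≤ 2 ^ (38 * (m * ⌈log₂ n ⌉)))
upper-bound n@(suc _) 2≤n
    with least (λ m → n ^ 2 ≤? m ^ 3) n (^-monoʳ-≤ n (n≤1+n 2))
... | zero , () , _
... | suc m₀′ , n²≤m₀³ , m₀-least with square-bracket m₀′
... | r′ , m₀≤r² , r²≤4m₀ = N , arrows , λ k n²≤k³ → N-small k (m₀-least k n²≤k³)
  where open Parameters n m₀′ r′ (pred (16 * suc m₀′)) 2≤n n²≤m₀³ m₀≤r² r²≤4m₀ refl

theorem1p3 : Σ ℕ λ a → Σ ℕ λ b → Σ ℕ λ a' → Σ ℕ λ b' →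
    1 ≤ a × 1 ≤ b × 1 ≤ a' × 1 ≤ b' ×
    (∀ n → 2 ≤ n →
    (∀ N → GrArrows N n → 2 ^ (a * (⌊log₂ n ⌋ * ⌊log₂ n ⌋)) ≤ N ^ b)
    ×
    (Σ ℕ λ N → GrArrows N n ×
    (∀ m → n ^ 2 ≤ m ^ 3 → N ^ b' ≤ 2 ^ (a' * (m * ⌈log₂ n ⌉)))))
theorem1p3 = 1 , 196 , 38 , 1 , ≤-refl , s≤s z≤n , s≤s z≤n , ≤-refl ,
  λ n 2≤n → lower-bound 196 ≤-refl n 2≤n , upper-bound n 2≤n
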